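{- Let $k \geq 2$ be an integer and let $G$ be a $(k+1)$-connected $(K_2 \cup kK_1)$-free graph with minimum degree $\delta(G) \geq \frac{3k-1}{2}$ and independence number $\alpha(G) < \frac{|V(G)|}{2}$ (for such graphs this condition is equivalent to $t(G) > 1$). Then $G$ is hamiltonian-connected.
   Context: All graphs are finite, undirected and simple. $K_2 \cup kK_1$ denotes the disjoint union of one edge $K_2$ and $k$ isolated vertices. A graph $G$ is $(K_2 \cup kK_1)$-free if it contains no induced subgraph isomorphic to $K_2 \cup kK_1$. $\delta(G)$ is the minimum degree and $\alpha(G)$ the independence number of $G$. The toughness $t(G)$ is $\min\{|S|/\omega(G-S) : S \subset V(G),\ \omega(G-S) \geq 2\}$, where $\omega(\cdot)$ is the number of components, and $t(G)=\infty$ if $G$ is complete. A graph $G$ is hamiltonian-connected if for every pair of distinct vertices $u,v$ of $G$ there is a $uv$-path containing all vertices of $G$. -}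

module Defs where

open import Data.Nat using (ℕ; suc; _+_; _*_; _∸_; _≤_; _<_)
open import Data.Fin using (Fin)
open import Data.Fin.Subset using (Subset; _∈_; _∉_; ∣_∣)
open import Data.Bool using (Bool)
open import Data.Vec using (tabulate)
open import Data.List using (List; []; _∷_; head; last)
open import Data.List.Membership.Propositional using () renaming (_∈_ to _∈ˡ_)
open import Data.List.Relation.Unary.Unique.Propositional using (Unique)
open import Data.List.Relation.Unary.Linked using (Linked)
open import Data.Maybe using (just)
open import Data.Product using (Σ; _×_; ∃; ∃-syntax)
open import Relation.Nullary using (¬_; does)
open import Relation.Binary using (Decidable)
open import Relation.Binary.PropositionalEquality using (_≡_)
open import Function using (Injective)

record Graph (n : ℕ) : Set₁ where
  field
    Adj  : Fin n → Fin n → Set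
    adj? : Decidable Adj
    sym  : ∀ {u v} → Adj u v → Adj v u
    irr  : ∀ {u} → ¬ Adj u u

module _ {n : ℕ} (G : Graph n) where
  open Graph G

  nbhd : Fin n → Subset n
  nbhd v = tabulate (λ w → does (adj? v w))

  degree : Fin n → ℕ
  degree v = ∣ nbhd v ∣

  MinDegree≥ : ℕ → Set
  MinDegree≥ d = ∀ v → d ≤ degree v

  Independent : Subset n → Set
  Independent I = ∀ u v → u ∈ I → v ∈ I → ¬ Adj u v

  data WalkAvoiding (S : Subset n) : Fin n → Fin n → Set where
    here : ∀ {u} → u ∉ S → WalkAvoiding S u u
    step : ∀ {u w v} → u ∉ S → Adj u w → WalkAvoiding S w v → WalkAvoiding S u v

  KConnected : ℕ → Set
  KConnected k = (k < n) ×
    (∀ (S : Subset n) → ∣ S ∣ < k → ∀ u v → u ∉ S → v ∉ S → WalkAvoiding S u v)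

  HasInducedK2∪kK1 : ℕ → Set
  HasInducedK2∪kK1 k = Σ (Fin n) λ a → Σ (Fin n) λ b → Σ (Fin k → Fin n) λ x →
    Adj a b ×
    Injective _≡_ _≡_ x ×
    (∀ i → ¬ (x i ≡ a)) × (∀ i → ¬ (x i ≡ b)) ×
    (∀ i → ¬ Adj a (x i)) × (∀ i → ¬ Adj b (x i)) ×
    (∀ i j → ¬ Adj (x i) (x j))

  K2∪kK1-free : ℕ → Set
  K2∪kK1-free k = ¬ HasInducedK2∪kK1 k

  HamPath : Fin n → Fin n → List (Fin n) → Set
  HamPath u v P = Unique P × (∀ w → w ∈ˡ P) × head P ≡ just u × last P ≡ just v
                  × Linked Adj P

  HamiltonianConnected : Set
  HamiltonianConnected = ∀ u v → ¬ (u ≡ v) → ∃[ P ] HamPath u v P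

{-# OPTIONS --safe #-}
module Submission where

-- Let P be a longest uv-path. Connectivity and freeness make G − P independent.
-- Let h lie outside P. Between consecutive neighbours of h on P lie arcs; the
-- first inner vertices of the arcs form an independent set with h, and so do
-- the last ones. A vertex with a neighbour in one of these two sets misses at
-- most k − 1 of its elements. For consecutive vertices z, z⁺ of P, exchange
-- arguments force the neighbours of z and z⁺ in the two sets into disjoint
-- intervals of the cyclic order, and since 2 δ(G) ≥ 3k − 1 three such intervals
-- do not fit. Classify the vertices by whether they see both sets, neither, or
-- exactly one; the vertices not seeing a given set are independent. If no vertex
-- seeing only last vertices has a successor on P, then on P vertices seeing both
-- sets are separated by vertices seeing neither, and one of the two independent
-- sets of vertices has at least n/2 elements. Otherwise counting arcs leaves
-- one configuration, with k = 3 and n = 11 (a Petersen graph in which one vertex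
-- is split into u and v, before adding edges), and there the degree condition
-- at a single vertex yields a Hamiltonian path.

-- The constant 3k - 1 is matched to one inequality. Let φ + k be the number of neighbours of `h` on
-- `P`; the degree condition then reads k ≤ 2φ + 1, and there are φ + k - 1 ≤ 3φ arcs. A vertex that
-- meets one of the two independent sets enlarged by `h` meets it in at least φ + 1 elements, so
-- three intervals need at least 3φ + 2 arcs even if one of them spends an element on `h`. At most
-- one arc, the one containing the edge z z⁺, can be counted twice, and this still leaves 3φ + 2
-- against 3φ + 1. The second concern is constructive. Every structural step derives a
-- contradiction, and no longest path is ever selected: Hamiltonian paths are decided by finite
-- search, and a failed search is refuted by extending an arbitrary path again and again.

open import Defs
open import Data.Nat using (ℕ; zero; suc; _+_; _*_; _∸_; _≤_; _<_; z≤n; s≤s; _≤?_)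
open import Data.Nat.Properties
open import Data.Fin using (Fin; zero; suc; inject≤)
open import Data.Fin.Patterns
import Data.Fin.Properties as Finₚ
open import Data.Fin.Subset using (Subset; _∈_; _∉_; ∣_∣) renaming (⊥ to ⊥ˢ)
open import Data.Fin.Subset.Properties using (∉⊥; ∣⊥∣≡0)
open import Data.Vec as Vec using ()
import Data.Vec.Properties as Vecₚ
open import Data.List using (List; []; _∷_; _++_; length; map; filter; reverse; lookup; tabulate; allFin; head; last)
open import Data.List.Properties using (unfold-reverse; length-++; ++-assoc; length-map; map-++; length-reverse; ++-identityʳ; length-tabulate)
open import Data.List.Membership.Propositional using (find; lose) renaming (_∈_ to _∈ˡ_; _∉_ to _∉ˡ_)
open import Data.List.Membership.Propositional.Properties using (∈-lookup; ∈-filter⁺; ∈-filter⁻; ∈-map⁻; ∈-map⁺; ∈-allFin; ∈-++⁺ˡ; ∈-++⁺ʳ; ∈-++⁻; ∈-∃++)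
open import Data.List.Relation.Unary.All as All using (All; []; _∷_)
open import Data.List.Relation.Unary.Any as Any using (Any; here; there)
open import Data.List.Relation.Unary.AllPairs as AllPairs using (AllPairs; []; _∷_)
import Data.List.Relation.Unary.AllPairs.Properties as AllPairsₚ
open import Data.List.Relation.Unary.Linked using (Linked; [-]; _∷_; linked?)
import Data.List.Relation.Unary.Linked.Properties as Linkedₚ
open import Data.List.Relation.Unary.Unique.Propositional using (Unique)
import Data.List.Relation.Unary.Unique.Propositional.Properties as Uniq
open import Data.List.Relation.Binary.Permutation.Propositional using (_↭_; prep; ↭-refl; ↭-trans; ↭-sym; ↭-reflexive; ↭⇒↭ₛ)
open import Data.List.Relation.Binary.Permutation.Propositional.Properties using (++⁺; ++⁺ˡ; ++⁺ʳ; ↭-reverse; ++-commutativeMonoid; ++-comm; shift; ∈-resp-↭; ↭-length)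
import Data.List.Relation.Binary.Permutation.Setoid.Properties as PermS
open import Data.Maybe using (Maybe; just; nothing)
open import Data.Maybe.Properties using (just-injective; ≡-dec)
open import Data.Product using (_×_; _,_; proj₁; proj₂; ∃; ∃₂)
open import Data.Sum using (_⊎_; inj₁; inj₂)
open import Data.Empty using (⊥; ⊥-elim)
open import Data.Unit using (⊤; tt)
open import Relation.Nullary using (¬_; Dec; yes; no; does)
open import Relation.Nullary.Decidable using (¬?; _×-dec_; _⊎-dec_; dec-true; decidable-stable; map′; True; toWitness)
open import Relation.Unary using (Decidable)
open import Relation.Binary using (tri<; tri≈; tri>)
open import Relation.Binary.PropositionalEquality using (_≡_; _≢_; refl; sym; trans; cong; cong₂; subst; subst₂; setoid; module ≡-Reasoning)
open import Function using (_∘_)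
import Algebra.Solver.CommutativeMonoid as CMSolver

-- Counting

ind : ∀ {p} {Q : Set p} → Dec Q → ℕ
ind (yes _) = 1
ind (no _)  = 0

ind-yes : ∀ {p} {Q : Set p} (d : Dec Q) → Q → ind d ≡ 1
ind-yes (yes _) _ = refl
ind-yes (no ¬q) q = ⊥-elim (¬q q)

ind≤1 : ∀ {p} {Q : Set p} (d : Dec Q) → ind d ≤ 1
ind≤1 (yes _) = ≤-refl
ind≤1 (no _)  = z≤n

module _ {A : Set} where

  sumOver : (A → ℕ) → List A → ℕ
  sumOver f []       = 0
  sumOver f (x ∷ xs) = f x + sumOver f xs

  count : {Q : A → Set} → Decidable Q → List A → ℕ
  count Q? = sumOver (λ x → ind (Q? x))

  sumOver-mono : ∀ {f g : A → ℕ} xs → (∀ {x} → x ∈ˡ xs → f x ≤ g x) → sumOver f xs ≤ sumOver g xs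
  sumOver-mono []       _   = z≤n
  sumOver-mono (x ∷ xs) f≤g = +-mono-≤ (f≤g (here refl)) (sumOver-mono xs (f≤g ∘ there))

  sumOver-+ : ∀ (f g : A → ℕ) xs → sumOver (λ x → f x + g x) xs ≡ sumOver f xs + sumOver g xs
  sumOver-+ f g []       = refl
  sumOver-+ f g (x ∷ xs) = begin
    f x + g x + sumOver (λ y → f y + g y) xs    ≡⟨ cong (f x + g x +_) (sumOver-+ f g xs) ⟩
    f x + g x + (sumOver f xs + sumOver g xs)   ≡⟨ +-assoc (f x) (g x) _ ⟩
    f x + (g x + (sumOver f xs + sumOver g xs)) ≡⟨ cong (f x +_) (x+[y+z]≡y+[x+z] (g x) (sumOver f xs) _) ⟩
    f x + (sumOver f xs + (g x + sumOver g xs)) ≡⟨ +-assoc (f x) _ _ ⟨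
    f x + sumOver f xs + (g x + sumOver g xs)   ∎
    where
    open ≡-Reasoning
    x+[y+z]≡y+[x+z] : ∀ x y z → x + (y + z) ≡ y + (x + z)
    x+[y+z]≡y+[x+z] x y z = trans (sym (+-assoc x y z)) (trans (cong (_+ z) (+-comm x y)) (+-assoc y x z))

  sumOver-const1 : ∀ xs → sumOver (λ _ → 1) xs ≡ length xs
  sumOver-const1 []       = refl
  sumOver-const1 (_ ∷ xs) = cong suc (sumOver-const1 xs)

  count-filter : ∀ {Q : A → Set} (Q? : Decidable Q) xs → count Q? xs ≡ length (filter Q? xs)
  count-filter Q? []       = refl
  count-filter Q? (x ∷ xs) with Q? x
  ... | yes _ = cong suc (count-filter Q? xs)
  ... | no  _ = count-filter Q? xs

  count-¬ : ∀ {Q : A → Set} (Q? : Decidable Q) xs → count Q? xs + length (filter (¬? ∘ Q?) xs) ≡ length xs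
  count-¬ Q? []       = refl
  count-¬ Q? (x ∷ xs) with Q? x
  ... | yes _ = cong suc (count-¬ Q? xs)
  ... | no  _ = trans (+-suc _ _) (cong suc (count-¬ Q? xs))

  count-any : ∀ {Q : A → Set} (Q? : Decidable Q) xs → 1 ≤ count Q? xs → Any Q xs
  count-any Q? (x ∷ xs) 1≤ with Q? x
  ... | yes q = here q
  ... | no  _ = there (count-any Q? xs 1≤)

  count-none : ∀ {Q : A → Set} (Q? : Decidable Q) xs → (∀ {x} → x ∈ˡ xs → ¬ Q x) → count Q? xs ≡ 0
  count-none Q? []       _    = refl
  count-none Q? (x ∷ xs) none with Q? x
  ... | yes q = ⊥-elim (none (here refl) q)
  ... | no  _ = count-none Q? xs (none ∘ there)

  count-atMostOne : ∀ {Q : A → Set} (Q? : Decidable Q) {xs} →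
    AllPairs (λ x y → Q x → Q y → ⊥) xs → count Q? xs ≤ 1
  count-atMostOne Q? {[]}     []       = z≤n
  count-atMostOne Q? {x ∷ xs} (h ∷ hs) with Q? x
  ... | yes q = s≤s (≤-reflexive (count-none Q? xs (λ y∈ → All.lookup h y∈ q)))
  ... | no  _ = count-atMostOne Q? hs

  length-⊆ : ∀ {xs ys : List A} → Unique xs → (∀ {x} → x ∈ˡ xs → x ∈ˡ ys) → length xs ≤ length ys
  length-⊆ {[]}     _        _   = z≤n
  length-⊆ {x ∷ xs} (x∉ ∷ u) sub with ∈-∃++ (sub (here refl))
  ... | as , bs , refl = begin
    suc (length xs)             ≤⟨ s≤s (length-⊆ u avoid) ⟩
    suc (length (as ++ bs))     ≡⟨ cong suc (length-++ as) ⟩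
    suc (length as + length bs) ≡⟨ +-suc (length as) (length bs) ⟨
    length as + suc (length bs) ≡⟨ length-++ as ⟨
    length (as ++ x ∷ bs)       ∎
    where
    open ≤-Reasoning
    avoid : ∀ {y} → y ∈ˡ xs → y ∈ˡ as ++ bs
    avoid y∈ with ∈-++⁻ as (sub (there y∈))
    ... | inj₁ y∈as           = ∈-++⁺ˡ y∈as
    ... | inj₂ (here refl)    = ⊥-elim (All.lookup x∉ y∈ refl)
    ... | inj₂ (there y∈bs)   = ∈-++⁺ʳ as y∈bs

  count-⊆ : ∀ {Q : A → Set} (Q? : Decidable Q) {xs ys} → Unique xs →
    (∀ {x} → x ∈ˡ xs → Q x → x ∈ˡ ys) → count Q? xs ≤ count Q? ys
  count-⊆ Q? {xs} {ys} u sub = begin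
    count Q? xs           ≡⟨ count-filter Q? xs ⟩
    length (filter Q? xs) ≤⟨ length-⊆ (Uniq.filter⁺ Q? u) (λ x∈ → let x∈xs , q = ∈-filter⁻ Q? x∈ in ∈-filter⁺ Q? (sub x∈xs q) q) ⟩
    length (filter Q? ys) ≡⟨ count-filter Q? ys ⟨
    count Q? ys           ∎
    where open ≤-Reasoning

sumOver-map : ∀ {A B : Set} (f : A → ℕ) (g : B → A) xs → sumOver f (map g xs) ≡ sumOver (f ∘ g) xs
sumOver-map f g []       = refl
sumOver-map f g (x ∷ xs) = cong (f (g x) +_) (sumOver-map f g xs)

AllPairs-total : ∀ {A : Set} {R : A → A → Set} {xs : List A} → AllPairs R xs → ∀ {p q} → p ∈ˡ xs → q ∈ˡ xs → p ≡ q ⊎ R p q ⊎ R q p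
AllPairs-total (_ ∷ _)  (here refl) (here refl) = inj₁ refl
AllPairs-total (r ∷ _)  (here refl) (there q∈)  = inj₂ (inj₁ (All.lookup r q∈))
AllPairs-total (r ∷ _)  (there p∈)  (here refl) = inj₂ (inj₂ (All.lookup r p∈))
AllPairs-total (_ ∷ rs) (there p∈)  (there q∈)  = AllPairs-total rs p∈ q∈

-- Positions in lists

module _ {A : Set} where

  data At : List A → ℕ → A → Set where
    here  : ∀ {x xs} → At (x ∷ xs) 0 x
    there : ∀ {x y xs i} → At xs i x → At (y ∷ xs) (suc i) x

  At-det : ∀ {xs i x y} → At xs i x → At xs i y → x ≡ y
  At-det here      here      = refl
  At-det (there p) (there q) = At-det p q

  At⇒∈ : ∀ {xs i x} → At xs i x → x ∈ˡ xs
  At⇒∈ here      = here refl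
  At⇒∈ (there p) = there (At⇒∈ p)

  ∈⇒At : ∀ {xs x} → x ∈ˡ xs → ∃ λ i → At xs i x
  ∈⇒At (here refl) = 0 , here
  ∈⇒At (there p)   = let i , q = ∈⇒At p in suc i , there q

  At-< : ∀ {xs i x} → At xs i x → i < length xs
  At-< here      = s≤s z≤n
  At-< (there p) = s≤s (At-< p)

  At-inj : ∀ {xs i j x} → Unique xs → At xs i x → At xs j x → i ≡ j
  At-inj _       here      here      = refl
  At-inj (h ∷ _) here      (there q) = ⊥-elim (All.lookup h (At⇒∈ q) refl)
  At-inj (h ∷ _) (there p) here      = ⊥-elim (All.lookup h (At⇒∈ p) refl)
  At-inj (_ ∷ u) (there p) (there q) = cong suc (At-inj u p q)

  At-≤ : ∀ {xs i j x} → At xs i x → j ≤ i → ∃ λ y → At xs j y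
  At-≤ here      z≤n     = _ , here
  At-≤ (there _) z≤n     = _ , here
  At-≤ (there p) (s≤s l) = let y , q = At-≤ p l in y , there q

  At-++ˡ : ∀ {xs ys i x} → At xs i x → At (xs ++ ys) i x
  At-++ˡ here      = here
  At-++ˡ (there p) = there (At-++ˡ p)

  At-++ʳ : ∀ xs {ys i x} → At ys i x → At (xs ++ ys) (length xs + i) x
  At-++ʳ []       p = p
  At-++ʳ (_ ∷ xs) p = there (At-++ʳ xs p)

  At-++⁻ˡ : ∀ xs {ys i x} → At (xs ++ ys) i x → i < length xs → At xs i x
  At-++⁻ˡ (_ ∷ _)  here      _       = here
  At-++⁻ˡ (_ ∷ xs) (there p) (s≤s l) = there (At-++⁻ˡ xs p l)

  At-++⁻ʳ : ∀ xs {ys i x} → At (xs ++ ys) i x → length xs ≤ i → At ys (i ∸ length xs) x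
  At-++⁻ʳ []       p         _       = p
  At-++⁻ʳ (_ ∷ xs) (there p) (s≤s l) = At-++⁻ʳ xs p l

At-map : ∀ {A B : Set} (f : A → B) {xs i x} → At xs i x → At (map f xs) i (f x)
At-map f here      = here
At-map f (there p) = there (At-map f p)

-- Segments: nonempty paths with named ends

module Segments {A : Set} (R : A → A → Set) where

  infixr 5 _◂_

  data Seg : A → A → List A → Set where
    one : ∀ {p} → Seg p p (p ∷ [])
    _◂_ : ∀ {p q r L} → R p r → Seg r q L → Seg p q (p ∷ L)

  join : ∀ {p q r s L M} → Seg p q L → R q r → Seg r s M → Seg p s (L ++ M)
  join one     e t = e ◂ t
  join (d ◂ s) e t = d ◂ join s e t

  reverseSeg : (∀ {p q} → R p q → R q p) → ∀ {p q L} → Seg p q L → Seg q p (reverse L)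
  reverseSeg sy one = one
  reverseSeg sy (_◂_ {p} {L = L} d s) =
    subst (Seg _ p) (sym (unfold-reverse p L)) (join (reverseSeg sy s) (sy d) one)

  Seg-head : ∀ {p q x L} → Seg p q L → At L 0 x → x ≡ p
  Seg-head one     here = refl
  Seg-head (_ ◂ _) here = refl

  first : ∀ {p q L} → Seg p q L → At L 0 p
  first one     = here
  first (_ ◂ _) = here

  final : ∀ {p q L} → Seg p q L → ∃ λ i → At L i q × suc i ≡ length L
  final one     = 0 , here , refl
  final (_ ◂ s) = let i , t , eq = final s in suc i , there t , cong suc eq

  cut : ∀ {p q L i x y} → Seg p q L → At L i x → At L (suc i) y →
    ∃₂ λ A C → L ≡ A ++ C × length A ≡ suc i × Seg p x A × R x y × Seg y q C
  cut one _ (there ())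
  cut (d ◂ s) here (there t) with Seg-head s t
  ... | refl = _ , _ , refl , refl , one , d , s
  cut (d ◂ s) (there t) (there t') =
    let A , C , eq , len , sA , e , sC = cut s t t'
    in _ ∷ A , C , cong (_ ∷_) eq , cong suc len , d ◂ sA , e , sC

  splitAt∷ : ∀ {p q a y} A {B} → Seg p q (a ∷ A ++ y ∷ B) →
    ∃ λ r → Seg p r (a ∷ A) × R r y × Seg y q (y ∷ B)
  splitAt∷ [] (d ◂ s) with Seg-head s here
  ... | refl = _ , one , d , s
  splitAt∷ (_ ∷ A) (d ◂ s) = let r , s₁ , e , s₂ = splitAt∷ A s in r , d ◂ s₁ , e , s₂

  dropFirst : ∀ {p q y L} → Seg p q L → At L 1 y → ∃ λ M → L ≡ p ∷ M × Seg y q M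
  dropFirst one     (there ())
  dropFirst (_ ◂ s) (there t) with Seg-head s t
  ... | refl = _ , refl , s

  cutAround : ∀ {p q L i x a y} → Seg p q L → At L i x → At L (suc i) a → At L (suc (suc i)) y →
    ∃₂ λ A C → L ≡ A ++ a ∷ C × length A ≡ suc i × Seg p x A × Seg y q C
  cutAround {i = i} {y = y} s tx ta ty with cut s tx ta
  ... | A , M , refl , len , sA , _ , sM
    with dropFirst sM (subst (λ j → At M j y) (trans (cong (suc (suc i) ∸_) len) (m+n∸n≡m 1 (suc i)))
                        (At-++⁻ʳ A ty (≤-trans (≤-reflexive len) (n≤1+n _))))
  ... | C , refl , sC = A , C , refl , len , sA , sC

  cut₂ : ∀ {p q L i j x y x' y'} → Seg p q L → At L i x → At L (suc i) y →
    At L j x' → At L (suc j) y' → i < j →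
    ∃ λ A → ∃₂ λ B C → L ≡ A ++ B ++ C × Seg p x A × Seg y x' B × Seg y' q C
  cut₂ {j = j} {y' = y'} s tx ty tx' ty' i<j with cut s tx ty
  ... | A , M , refl , len , sA , _ , sM
    with cut sM (At-++⁻ʳ A tx' |A|≤j)
                (subst (λ l → At M l y') (+-∸-assoc 1 |A|≤j) (At-++⁻ʳ A ty' (m≤n⇒m≤1+n |A|≤j)))
    where
    |A|≤j : length A ≤ j
    |A|≤j = ≤-trans (≤-reflexive len) i<j
  ... | B , C , refl , _ , sB , _ , sC = A , B , C , refl , sA , sB , sC

  module _ {p q L i x a y} (s : Seg p q L) (tx : At L i x) (ta : At L (suc i) a)
           (ty : At L (suc (suc i)) y) {j r t} (tr : At L j r) (tt : At L (suc j) t) where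

    cutAround-before : j < i →
      ∃ λ A → ∃₂ λ B C → L ≡ (A ++ B) ++ a ∷ C × Seg p r A × Seg t x B × Seg y q C
    cutAround-before j<i with cutAround s tx ta ty
    ... | M , C , refl , len , sM , sC
      with cut sM (At-++⁻ˡ M tr (≤-trans (m<n⇒m<1+n j<i) (≤-reflexive (sym len))))
                  (At-++⁻ˡ M tt (≤-trans (s≤s j<i) (≤-reflexive (sym len))))
    ... | A , B , refl , _ , sA , _ , sB = A , B , C , refl , sA , sB , sC

    cutAround-after : suc i < j →
      ∃ λ A → ∃₂ λ B C → L ≡ A ++ a ∷ (B ++ C) × Seg p x A × Seg y r B × Seg t q C
    cutAround-after 1+i<j with cutAround s tx ta ty
    ... | A , M , refl , len , sA , sM
      with cut sM (At-tail tr 1+i<j)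
                  (subst (λ l → At M l t) (+-∸-assoc 1 1+i<j) (At-tail tt (m≤n⇒m≤1+n 1+i<j)))
      where
      |Aa| : length (A ++ a ∷ []) ≡ suc (suc i)
      |Aa| = trans (length-++ A) (trans (+-comm (length A) 1) (cong suc len))
      At-tail : ∀ {l v} → At (A ++ a ∷ M) l v → suc (suc i) ≤ l → At M (l ∸ suc (suc i)) v
      At-tail {l} {v} tv le = subst (λ m → At M (l ∸ m) v) |Aa|
        (At-++⁻ʳ (A ++ a ∷ []) (subst (λ N → At N l v) (sym (++-assoc A (a ∷ []) M)) tv)
                 (≤-trans (≤-reflexive |Aa|) le))
    ... | B , C , refl , _ , sB , _ , sC = A , B , C , refl , sA , sB , sC

-- A cyclic sequence cut open between z and z⁺ that cannot absorb any list of
-- vertices satisfying Extra.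
module Rotations {A : Set} (R : A → A → Set) (sy : ∀ {p q} → R p q → R q p)
  (D : List A) {z⁺ z : A} (sD : Segments.Seg R z⁺ z D)
  (Extra : List A → Set)
  (maximal : ∀ {K p q L} → Extra K → Segments.Seg R p q L → R q p → L ↭ K ++ D → ⊥)
  where

  open Segments R
  open CMSolver (++-commutativeMonoid {A = A}) using (solve; _⊕_; _⊜_)

  private
    rev : ∀ {p q L} → Seg p q L → Seg q p (reverse L)
    rev = reverseSeg sy

    r↭ : ∀ (L : List A) → reverse L ↭ L
    r↭ = ↭-reverse

  insert : ∀ {K k₁ k₂} → Extra K → Seg k₁ k₂ K → R z k₁ → R k₂ z⁺ → ⊥
  insert ex sK e₁ e₂ = maximal ex (join sK e₂ sD) e₁ ↭-refl

  -- The new cycle runs through `K`, back from `p` to `z⁺`, and on from `q` to `z`.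
  cross : ∀ {K k₁ k₂ i p q} → Extra K → Seg k₁ k₂ K → At D i p → At D (suc i) q →
    R z k₁ → R k₂ p → R z⁺ q → ⊥
  cross {K} ex sK tp tq e₁ e₂ e with cut sD tp tq
  ... | A , C , refl , _ , sA , _ , sC =
    maximal ex (join sK e₂ (join (rev sA) e sC)) e₁ (++⁺ˡ K (++⁺ʳ C (r↭ A)))

  module _ (h : A) (exh : Extra (h ∷ [])) where

    cross′ : ∀ {i p q} → At D i p → At D (suc i) q → R h z⁺ → R h q → R z p → ⊥
    cross′ tp tq e₁ e₂ e with cut sD tp tq
    ... | A , C , refl , _ , sA , _ , sC =
      maximal exh (e₂ ◂ join sC e (rev sA)) (sy e₁)
        (prep h (↭-trans (++⁺ˡ C (r↭ A)) (++-comm C A)))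

    -- `h` bridges `z` and `p` while `r` bridges `z⁺` and `q`, so two outside vertices are absorbed
    -- at once.
    crossVia : ∀ {i p q} (r : A) → Extra (h ∷ r ∷ []) → At D i p → At D (suc i) q →
      R h z → R h p → R r z⁺ → R r q → ⊥
    crossVia r ex tp tq e₁ e₂ e₃ e₄ with cut sD tp tq
    ... | A , C , refl , _ , sA , _ , sC =
      maximal ex (e₂ ◂ join (rev sA) (sy e₃) (e₄ ◂ sC)) (sy e₁)
        (prep h (↭-trans (shift r (reverse A) C) (prep r (++⁺ʳ C (r↭ A)))))

    crossVia′ : ∀ {i p q} (r : A) → Extra (h ∷ r ∷ []) → At D i p → At D (suc i) q →
      R h z⁺ → R h q → R r z → R r p → ⊥
    crossVia′ r ex tp tq e₁ e₂ e₃ e₄ with cut sD tp tq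
    ... | A , C , refl , _ , sA , _ , sC =
      maximal ex (e₂ ◂ join sC (sy e₃) (e₄ ◂ rev sA)) (sy e₁)
        (prep h (↭-trans (shift r C (reverse A)) (prep r (↭-trans (++⁺ˡ C (r↭ A)) (++-comm C A)))))

    -- In the four names the first word describes the vertex seen by `z` and the second the one seen
    -- by `z⁺`: `succ` is the successor `q` of a neighbour `p` of `h`, `pred` the predecessor `p` of
    -- a neighbour `q`. Each cycle reassembles the three pieces `z⁺…p₁`, `q₁…p₂`, `q₂…z`.
    module _ {i j p₁ q₁ p₂ q₂} (tp₁ : At D i p₁) (tq₁ : At D (suc i) q₁)
             (tp₂ : At D j p₂) (tq₂ : At D (suc j) q₂) (i<j : i < j) where

      succ-succ : R h p₁ → R h p₂ → R z q₁ → R z⁺ q₂ → ⊥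
      succ-succ h₁ h₂ e₁ e₂ with cut₂ sD tp₁ tq₁ tp₂ tq₂ i<j
      ... | A , B , C , refl , sA , sB , sC =
        maximal exh (h₂ ◂ join (rev sB) (sy e₁) (join (rev sC) (sy e₂) sA)) (sy h₁)
          (prep h (↭-trans (++⁺ (r↭ B) (++⁺ʳ A (r↭ C)))
            (solve 3 (λ a b c → b ⊕ (c ⊕ a) ⊜ a ⊕ (b ⊕ c)) ↭-refl A B C)))

      pred-pred : R h q₁ → R h q₂ → R z p₁ → R z⁺ p₂ → ⊥
      pred-pred h₁ h₂ e₁ e₂ with cut₂ sD tp₁ tq₁ tp₂ tq₂ i<j
      ... | A , B , C , refl , sA , sB , sC =
        maximal exh (h₁ ◂ join sB (sy e₂) (join sA (sy e₁) (rev sC))) (sy h₂)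
          (prep h (↭-trans (++⁺ˡ B (++⁺ˡ A (r↭ C)))
            (solve 3 (λ a b c → b ⊕ (a ⊕ c) ⊜ a ⊕ (b ⊕ c)) ↭-refl A B C)))

      succ-pred : R h p₁ → R h q₂ → R z q₁ → R z⁺ p₂ → ⊥
      succ-pred h₁ h₂ e₁ e₂ with cut₂ sD tp₁ tq₁ tp₂ tq₂ i<j
      ... | A , B , C , refl , sA , sB , sC =
        maximal exh (h₂ ◂ join sC e₁ (join sB (sy e₂) sA)) (sy h₁)
          (prep h (solve 3 (λ a b c → c ⊕ (b ⊕ a) ⊜ a ⊕ (b ⊕ c)) ↭-refl A B C))

      pred-succ : R h p₁ → R h q₂ → R z⁺ q₁ → R z p₂ → ⊥
      pred-succ h₁ h₂ e₁ e₂ with cut₂ sD tp₁ tq₁ tp₂ tq₂ i<j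
      ... | A , B , C , refl , sA , sB , sC =
        maximal exh (h₂ ◂ join sC e₂ (join (rev sB) (sy e₁) sA)) (sy h₁)
          (prep h (↭-trans (++⁺ˡ C (++⁺ʳ A (r↭ B)))
            (solve 3 (λ a b c → c ⊕ (b ⊕ a) ⊜ a ⊕ (b ⊕ c)) ↭-refl A B C)))

    -- A vertex a adjacent to both z and z⁺ is moved between them, and h is
    -- used to close the gap it leaves.
    module _ {i x a y} (tx : At D i x) (ta : At D (suc i) a) (ty : At D (suc (suc i)) y)
             (za : R z a) (z⁺a : R z⁺ a) where

      move-single : R h x → R h y → ⊥
      move-single hx hy with cutAround sD tx ta ty
      ... | A , C , refl , _ , sA , sC =
        maximal exh (hy ◂ join sC za (sy z⁺a ◂ sA)) (sy hx)
          (prep h (↭-trans (shift a C A) (↭-trans (prep a (++-comm C A)) (↭-sym (shift a A C)))))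

      module _ {j p q} (tp : At D j p) (tq : At D (suc j) q) where

        move-succ : R h x → R h p → R y q → j ≢ i → j ≢ suc i → ⊥
        move-succ hx hp yq j≢i j≢1+i with <-cmp j i
        ... | tri≈ _ j≡i _ = j≢i j≡i
        ... | tri< j<i _ _ with cutAround-before sD tx ta ty tp tq j<i
        ...   | A , B , C , refl , sA , sB , sC =
          maximal exh (hx ◂ join (rev sB) (sy yq) (join sC za (sy z⁺a ◂ sA))) (sy hp)
            (prep h (↭-trans (++⁺ʳ (C ++ a ∷ A) (r↭ B))
              (solve 4 (λ a b c d → b ⊕ (c ⊕ (d ⊕ a)) ⊜ (a ⊕ b) ⊕ (d ⊕ c)) ↭-refl A B C (a ∷ []))))
        move-succ hx hp yq j≢i j≢1+i | tri> _ _ i<j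
          with cutAround-after sD tx ta ty tp tq (≤∧≢⇒< i<j (j≢1+i ∘ sym))
        ...   | A , B , C , refl , sA , sB , sC =
          maximal exh (hp ◂ join (rev sB) yq (join sC za (sy z⁺a ◂ sA))) (sy hx)
            (prep h (↭-trans (++⁺ʳ (C ++ a ∷ A) (r↭ B))
              (solve 4 (λ a b c d → b ⊕ (c ⊕ (d ⊕ a)) ⊜ a ⊕ (d ⊕ (b ⊕ c))) ↭-refl A B C (a ∷ []))))

        move-pred : R h y → R h q → R x p → j ≢ i → j ≢ suc i → ⊥
        move-pred hy hq xp j≢i j≢1+i with <-cmp j i
        ... | tri≈ _ j≡i _ = j≢i j≡i
        ... | tri< j<i _ _ with cutAround-before sD tx ta ty tp tq j<i
        ...   | A , B , C , refl , sA , sB , sC =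
          maximal exh (hq ◂ join sB xp (join (rev sA) z⁺a (sy za ◂ rev sC))) (sy hy)
            (prep h (↭-trans (++⁺ˡ B (++⁺ (r↭ A) (prep a (r↭ C))))
              (solve 4 (λ a b c d → b ⊕ (a ⊕ (d ⊕ c)) ⊜ (a ⊕ b) ⊕ (d ⊕ c)) ↭-refl A B C (a ∷ []))))
        move-pred hy hq xp j≢i j≢1+i | tri> _ _ i<j
          with cutAround-after sD tx ta ty tp tq (≤∧≢⇒< i<j (j≢1+i ∘ sym))
        ...   | A , B , C , refl , sA , sB , sC =
          maximal exh (hy ◂ join sB (sy xp) (join (rev sA) z⁺a (sy za ◂ rev sC))) (sy hq)
            (prep h (↭-trans (++⁺ˡ B (++⁺ (r↭ A) (prep a (r↭ C))))
              (solve 4 (λ a b c d → b ⊕ (a ⊕ (d ⊕ c)) ⊜ a ⊕ (d ⊕ (b ⊕ c))) ↭-refl A B C (a ∷ []))))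

-- Cyclic positions, and exchanges on a uv-path closed up by an extra vertex

Unique-resp-↭ : ∀ {A : Set} {xs ys : List A} → xs ↭ ys → Unique xs → Unique ys
Unique-resp-↭ {A} p = PermS.Unique-resp-↭ (setoid A) (↭⇒↭ₛ p)

-- The position of index i in a list of length N followed by one extra
-- element, read cyclically starting just after index m.
rotated : ℕ → ℕ → ℕ → ℕ
rotated N m i with i ≤? m
... | yes _ = (N ∸ suc m) + suc i
... | no  _ = i ∸ suc m

∸-suc : ∀ {a b} → b < a → a ∸ b ≡ suc (a ∸ suc b)
∸-suc {suc a} {b} (s≤s b≤a) = +-∸-assoc 1 b≤a

module _ (N m : ℕ) where

  rotated-≤ : ∀ {i} → i ≤ m → rotated N m i ≡ (N ∸ suc m) + suc i
  rotated-≤ {i} i≤m with i ≤? m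
  ... | yes _ = refl
  ... | no ¬p = ⊥-elim (¬p i≤m)

  rotated-> : ∀ {i} → m < i → rotated N m i ≡ i ∸ suc m
  rotated-> {i} m<i with i ≤? m
  ... | yes p = ⊥-elim (<⇒≱ m<i p)
  ... | no _  = refl

  rotated-suc : ∀ {i} → i ≢ m → rotated N m (suc i) ≡ suc (rotated N m i)
  rotated-suc {i} i≢m with i ≤? m
  ... | yes i≤m = trans (rotated-≤ (≤∧≢⇒< i≤m i≢m)) (+-suc (N ∸ suc m) (suc i))
  ... | no  i≰m = trans (rotated-> (m≤n⇒m≤1+n (≰⇒> i≰m))) (+-∸-assoc 1 (≰⇒> i≰m))

  rotated-< : ∀ {i j} → i < j → j ≤ m ⊎ m < i → rotated N m i < rotated N m j
  rotated-< i<j (inj₁ j≤m) rewrite rotated-≤ (≤-trans (<⇒≤ i<j) j≤m) | rotated-≤ j≤m = +-monoʳ-< (N ∸ suc m) (s≤s i<j)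
  rotated-< i<j (inj₂ m<i) rewrite rotated-> m<i | rotated-> (<-trans m<i i<j) = ∸-monoˡ-< i<j m<i

  rotated-wrap : ∀ {i j} → i < N → m < i → j ≤ m → rotated N m i < rotated N m j
  rotated-wrap {i} {j} i<N m<i j≤m rewrite rotated-> m<i | rotated-≤ j≤m = begin-strict
    i ∸ suc m         ≤⟨ ∸-monoˡ-≤ (suc m) (<⇒≤ i<N) ⟩
    N ∸ suc m         <⟨ m<m+n (N ∸ suc m) {suc j} (s≤s z≤n) ⟩
    N ∸ suc m + suc j ∎
    where open ≤-Reasoning

  -- Lets orders obtained from two consecutive cuts of the same path be compared.
  rotated-shift : ∀ {i} → suc m < N → i ≢ m → i ≢ suc m → rotated N m i ≡ suc (rotated N (suc m) i)
  rotated-shift {i} 1+m<N i≢m i≢1+m with i ≤? m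
  ... | yes i≤m with i ≤? suc m
  ...   | yes _ = cong (_+ suc i) (∸-suc 1+m<N)
  ...   | no ¬p = ⊥-elim (¬p (m≤n⇒m≤1+n i≤m))
  rotated-shift {i} 1+m<N i≢m i≢1+m | no i≰m with i ≤? suc m
  ...   | yes p = ⊥-elim (i≢1+m (≤-antisym p (≰⇒> i≰m)))
  ...   | no ¬p = ∸-suc (≰⇒> ¬p)

Path : ∀ {n} → Graph n → Fin n → Fin n → List (Fin n) → Set
Path G = Segments.Seg (Graph.Adj G)

module _ {n : ℕ} (G : Graph n) (u v : Fin n) where
  open Graph G renaming (sym to adj-sym)
  private module S = Segments Adj

  -- A uv-path becomes a cycle through the extra vertex `nothing`, whose only
  -- neighbours are u and v; real edges of the cycle can then be exchanged freely.
  Adj* : Maybe (Fin n) → Maybe (Fin n) → Set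
  Adj* (just p) (just q) = Adj p q
  Adj* nothing  (just q) = q ≡ u ⊎ q ≡ v
  Adj* (just p) nothing  = p ≡ u ⊎ p ≡ v
  Adj* nothing  nothing  = ⊥

  Adj*-sym : ∀ {p q} → Adj* p q → Adj* q p
  Adj*-sym {just _}  {just _}  e = adj-sym e
  Adj*-sym {just _}  {nothing} e = e
  Adj*-sym {nothing} {just _}  e = e

  module S* = Segments Adj*

  Path* : Maybe (Fin n) → Maybe (Fin n) → List (Maybe (Fin n)) → Set
  Path* = S*.Seg

  Path⇒Path* : ∀ {p q L} → Path G p q L → Path* (just p) (just q) (map just L)
  Path⇒Path* S.one       = S*.one
  Path⇒Path* (e S.◂ s) = e S*.◂ Path⇒Path* s

  Path*⇒Path : ∀ {p* q* M} → Path* p* q* M → nothing ∉ˡ M →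
    ∃₂ λ p q → ∃ λ L → p* ≡ just p × q* ≡ just q × M ≡ map just L × Path G p q L
  Path*⇒Path {just p} S*.one _ = p , p , _ , refl , refl , refl , S.one
  Path*⇒Path {nothing} S*.one ∉ = ⊥-elim (∉ (here refl))
  Path*⇒Path {nothing} (_ S*.◂ _) ∉ = ⊥-elim (∉ (here refl))
  Path*⇒Path {just p} (e S*.◂ s) ∉ with Path*⇒Path s (∉ ∘ there)
  ... | r , q , L , refl , refl , refl , s' = p , q , p ∷ L , refl , refl , refl , e S.◂ s'

  rotateTo : ∀ {p q y} A {B} → Path* p q (A ++ y ∷ B) → Adj* q p →
    ∃ λ r → Path* y r (y ∷ B ++ A) × Adj* r y
  rotateTo [] {B} s e with subst (λ L → Path* _ _ (_ ∷ L)) (sym (++-identityʳ B)) s | S*.Seg-head s here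
  ... | s′ | refl = _ , s′ , e
  rotateTo (a ∷ A) s e = let r , s₁ , d , s₂ = S*.splitAt∷ A s in r , S*.join s₂ e s₁ , d

  Seg-loop : ∀ {p L} → Path G p p L → Unique L → length L ≡ 1
  Seg-loop S.one _ = refl
  Seg-loop (_ S.◂ s) (h ∷ _) = ⊥-elim (All.lookup h (At⇒∈ (proj₁ (proj₂ (S.final s)))) refl)

  uncons : ∀ {y r M} → Path* y r (y ∷ M) → M ≡ [] ⊎ ∃ λ p → Adj* y p × Path* p r M
  uncons S*.one      = inj₁ refl
  uncons (d S*.◂ s) = inj₂ (_ , d , s)

  -- Opening the cycle at `nothing` leaves a path whose ends are neighbours of `nothing`, hence `u`
  -- and `v` in some order. The length bound keeps a single vertex from being both ends.
  cycle⇒path : ∀ {p q L} → Path* p q L → Adj* q p → Unique L → nothing ∈ˡ L → 3 ≤ length L →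
    ∃ λ Q → Path G u v Q × Unique Q × suc (length Q) ≡ length L
  cycle⇒path s e uL n∈ 3≤ with ∈-∃++ n∈
  ... | A , B , refl with rotateTo A s e | ↭-trans (shift nothing A B) (prep nothing (++-comm A B))
  ... | r , s′ , e′ | perm with uncons s′ | Unique-resp-↭ perm uL | ↭-length perm
  ... | inj₁ M≡[] | _ | len = ⊥-elim (<⇒≱ (n<1+n 2) (≤-trans 3≤ (≤-trans (≤-reflexive (trans len (cong (suc ∘ length) M≡[]))) (n≤1+n 1))))
  ... | inj₂ (_ , d , s″) | (∉M ∷ uM) | len with Path*⇒Path s″ (λ ∈M → All.lookup ∉M ∈M refl)
  ... | p₀ , q₀ , Q , refl , refl , eqQ , sQ = finish d e′ sQ
    where
    uQ : Unique Q
    uQ = Uniq.map⁻ (subst Unique eqQ uM)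
    lenQ : suc (length Q) ≡ length (A ++ nothing ∷ B)
    lenQ = trans (cong suc (sym (trans (cong length eqQ) (length-map just Q)))) (sym len)
    no-loop : length Q ≢ 1
    no-loop l = <⇒≱ (≤-reflexive (cong suc (trans (sym lenQ) (cong suc l)))) 3≤
    finish : ∀ {p q} → p ≡ u ⊎ p ≡ v → q ≡ u ⊎ q ≡ v → Path G p q Q →
      ∃ λ Q → Path G u v Q × Unique Q × suc (length Q) ≡ length (A ++ nothing ∷ B)
    finish (inj₁ refl) (inj₁ refl) sQ = ⊥-elim (no-loop (Seg-loop sQ uQ))
    finish (inj₁ refl) (inj₂ refl) sQ = Q , sQ , uQ , lenQ
    finish (inj₂ refl) (inj₁ refl) sQ = reverse Q , S.reverseSeg adj-sym sQ , Unique-resp-↭ (↭-sym (↭-reverse Q)) uQ , trans (cong suc (length-reverse Q)) lenQ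
    finish (inj₂ refl) (inj₂ refl) sQ = ⊥-elim (no-loop (Seg-loop sQ uQ))

  module LongestPath (P : List (Fin n)) (sP : Path G u v P) (uP : Unique P)
    (noLonger : ∀ {Q} → Path G u v Q → Unique Q → length P < length Q → ⊥) where

    Detour : Fin n → Fin n → Set
    Detour k₁ k₂ = ∃ λ K → Path G k₁ k₂ K × Unique K × All (_∉ˡ P) K

    -- Nonempty by construction, so that absorbing such a list makes the path strictly longer.
    data Outside : List (Maybe (Fin n)) → Set where
      outside : ∀ k K → Unique (k ∷ K) → All (_∉ˡ P) (k ∷ K) → Outside (map just (k ∷ K))

    outside-path : ∀ {p q K} → Path G p q K → Unique K → All (_∉ˡ P) K → Outside (map just K)
    outside-path S.one       uK K∉ = outside _ _ uK K∉
    outside-path (_ S.◂ _) uK K∉ = outside _ _ uK K∉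

    outside₁ : ∀ {h} → h ∉ˡ P → Outside (just h ∷ [])
    outside₁ h∉ = outside _ [] ([] ∷ []) (h∉ ∷ [])

    outside₂ : ∀ {h r} → h ∉ˡ P → r ∉ˡ P → r ≢ h → Outside (just h ∷ just r ∷ [])
    outside₂ h∉ r∉ r≢h = outside _ _ (((r≢h ∘ sym) ∷ []) ∷ [] ∷ []) (h∉ ∷ r∉ ∷ [])

    module At-Cut {m z z⁺} (tz : At P m z) (tz⁺ : At P (suc m) z⁺) where

      private
        split = S.cut sP tz tz⁺
        P₁ P₂ : List (Fin n)
        P₁ = proj₁ split
        P₂ = proj₁ (proj₂ split)
        P≡ : P ≡ P₁ ++ P₂
        P≡ = proj₁ (proj₂ (proj₂ split))
        |P₁| : length P₁ ≡ suc m
        |P₁| = proj₁ (proj₂ (proj₂ (proj₂ split)))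
        s₁ : Path G u z P₁
        s₁ = proj₁ (proj₂ (proj₂ (proj₂ (proj₂ split))))
        s₂ : Path G z⁺ v P₂
        s₂ = proj₂ (proj₂ (proj₂ (proj₂ (proj₂ (proj₂ split)))))

      z~z⁺ : Adj z z⁺
      z~z⁺ = proj₁ (proj₂ (proj₂ (proj₂ (proj₂ (proj₂ split)))))

      -- The cycle read from `z⁺` to `v`, through `nothing`, then from `u` to `z`: the closed path
      -- with the edge z z⁺ cut.
      D : List (Maybe (Fin n))
      D = map just P₂ ++ nothing ∷ map just P₁

      sD : Path* (just z⁺) (just z) D
      sD = S*.join (Path⇒Path* s₂) (inj₂ refl) (inj₁ refl S*.◂ Path⇒Path* s₁)

      κ : ℕ → ℕ
      κ = rotated (length P) m

      |P₂| : length P₂ ≡ length P ∸ suc m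
      |P₂| = sym (trans (cong₂ _∸_ (trans (cong length P≡) (length-++ P₁)) (sym |P₁|)) (m+n∸m≡n (length P₁) (length P₂)))

      atD : ∀ {i p} → At P i p → At D (κ i) (just p)
      atD {i} {p} t with i ≤? m
      ... | yes i≤m = subst (λ j → At D j (just p)) (cong (_+ suc i) (trans (length-map just P₂) |P₂|))
            (At-++ʳ (map just P₂) (there (At-map just (At-++⁻ˡ P₁ (subst (λ L → At L i p) P≡ t) (≤-trans (s≤s i≤m) (≤-reflexive (sym |P₁|)))))))
      ... | no i≰m = subst (λ j → At D (i ∸ j) (just p)) |P₁|
            (At-++ˡ (At-map just (At-++⁻ʳ P₁ (subst (λ L → At L i p) P≡ t) (≤-trans (≤-reflexive |P₁|) (≰⇒> i≰m)))))

      atD-suc : ∀ {i p} → i ≢ m → At P (suc i) p → At D (suc (κ i)) (just p)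
      atD-suc {i} {p} i≢m t = subst (λ j → At D j (just p)) (rotated-suc (length P) m i≢m) (atD t)

      D↭ : D ↭ nothing ∷ map just P
      D↭ = ↭-trans (shift nothing (map just P₂) (map just P₁))
             (prep nothing (↭-trans (++-comm (map just P₂) (map just P₁))
               (↭-reflexive (sym (trans (cong (map just) P≡) (map-++ just P₁ P₂))))))

      longer : ∀ {k K L} → L ↭ map just (k ∷ K) ++ D → suc (suc (length P)) ≤ length L
      longer {k} {K} {L} perm = begin
        suc (suc (length P))                    ≡⟨ cong (2 +_) (length-map just P) ⟨
        suc (length (nothing ∷ map just P))     ≡⟨ cong suc (↭-length D↭) ⟨
        suc (length D)                          ≤⟨ s≤s (m≤n+m (length D) (length (map just K))) ⟩
        suc (length (map just K) + length D)    ≡⟨ cong suc (length-++ (map just K)) ⟨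
        length (map just (k ∷ K) ++ D)          ≡⟨ ↭-length perm ⟨
        length L                                ∎
        where open ≤-Reasoning

      maximal : ∀ {K p q L} → Outside K → Path* p q L → Adj* q p → L ↭ K ++ D → ⊥
      maximal {L = L} (outside k K uK K∉P) s e perm
        with cycle⇒path s e uL n∈L (≤-trans (s≤s (s≤s 1≤|P|)) (longer {k} {K} perm))
        where
        perm′ : L ↭ map just (k ∷ K) ++ nothing ∷ map just P
        perm′ = ↭-trans perm (++⁺ˡ (map just (k ∷ K)) D↭)
        disjoint : ∀ {y} → y ∈ˡ map just (k ∷ K) × y ∈ˡ nothing ∷ map just P → ⊥
        disjoint (y∈K , y∈P) with ∈-map⁻ just y∈K
        disjoint (y∈K , here ())   | _ , _ , refl
        disjoint (y∈K , there y∈P) | _ , y′∈ , refl with ∈-map⁻ just y∈P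
        ... | _ , y′∈P , refl = All.lookup K∉P y′∈ y′∈P
        nothing∉ : nothing ∉ˡ map just P
        nothing∉ n∈ with ∈-map⁻ just n∈
        ... | _ , _ , ()
        uL : Unique L
        uL = Unique-resp-↭ (↭-sym perm′) (Uniq.++⁺ (Uniq.map⁺ just-injective uK)
          (All.tabulate (λ y∈ eq → nothing∉ (subst (_∈ˡ map just P) (sym eq) y∈)) ∷ Uniq.map⁺ just-injective uP)
          disjoint)
        n∈L : nothing ∈ˡ L
        n∈L = ∈-resp-↭ (↭-sym perm′) (∈-++⁺ʳ (map just (k ∷ K)) (here refl))
        1≤|P| : 1 ≤ length P
        1≤|P| = let _ , _ , eq = S.final sP in ≤-trans (s≤s z≤n) (≤-reflexive eq)
      ... | Q , sQ , uQ , lenQ = noLonger sQ uQ (≤-pred (≤-trans (longer {k} {K} perm) (≤-reflexive (sym lenQ))))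

      private
        module R = Rotations Adj* (λ {p} {q} → Adj*-sym {p} {q}) D sD Outside maximal

      κ-inj : ∀ {i j p q} → At P i p → At P j q → κ i ≡ κ j → p ≡ q
      κ-inj tp tq eq = just-injective (At-det (subst (λ l → At D l _) eq (atD tp)) (atD tq))

      insert : ∀ {k₁ k₂} → Detour k₁ k₂ → Adj z k₁ → Adj k₂ z⁺ → ⊥
      insert (K , s , uK , K∉) = R.insert (outside-path s uK K∉) (Path⇒Path* s)

      cross : ∀ {k₁ k₂ i p q} → Detour k₁ k₂ → At P i p → At P (suc i) q → i ≢ m →
        Adj z k₁ → Adj k₂ p → Adj z⁺ q → ⊥
      cross (K , s , uK , K∉) tp tq i≢m = R.cross (outside-path s uK K∉) (Path⇒Path* s) (atD tp) (atD-suc i≢m tq)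

      module Through {h} (h∉ : h ∉ˡ P) where

        module _ {i p q} (tp : At P i p) (tq : At P (suc i) q) (i≢m : i ≢ m) where

          cross′ : Adj h z⁺ → Adj h q → Adj z p → ⊥
          cross′ = R.cross′ (just h) (outside₁ h∉) (atD tp) (atD-suc i≢m tq)

          crossVia : ∀ {r} → r ∉ˡ P → r ≢ h → Adj h z → Adj h p → Adj r z⁺ → Adj r q → ⊥
          crossVia {r} r∉ r≢h = R.crossVia (just h) (outside₁ h∉) (just r) (outside₂ h∉ r∉ r≢h) (atD tp) (atD-suc i≢m tq)

          crossVia′ : ∀ {r} → r ∉ˡ P → r ≢ h → Adj h z⁺ → Adj h q → Adj r z → Adj r p → ⊥
          crossVia′ {r} r∉ r≢h = R.crossVia′ (just h) (outside₁ h∉) (just r) (outside₂ h∉ r∉ r≢h) (atD tp) (atD-suc i≢m tq)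

        module _ {i j p₁ q₁ p₂ q₂} (tp₁ : At P i p₁) (tq₁ : At P (suc i) q₁) (i≢m : i ≢ m)
                 (tp₂ : At P j p₂) (tq₂ : At P (suc j) q₂) (j≢m : j ≢ m) (lt : κ i < κ j) where

          succ-succ : Adj h p₁ → Adj h p₂ → Adj z q₁ → Adj z⁺ q₂ → ⊥
          succ-succ = R.succ-succ (just h) (outside₁ h∉) (atD tp₁) (atD-suc i≢m tq₁) (atD tp₂) (atD-suc j≢m tq₂) lt

          pred-pred : Adj h q₁ → Adj h q₂ → Adj z p₁ → Adj z⁺ p₂ → ⊥
          pred-pred = R.pred-pred (just h) (outside₁ h∉) (atD tp₁) (atD-suc i≢m tq₁) (atD tp₂) (atD-suc j≢m tq₂) lt

          succ-pred : Adj h p₁ → Adj h q₂ → Adj z q₁ → Adj z⁺ p₂ → ⊥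
          succ-pred = R.succ-pred (just h) (outside₁ h∉) (atD tp₁) (atD-suc i≢m tq₁) (atD tp₂) (atD-suc j≢m tq₂) lt

          pred-succ : Adj h p₁ → Adj h q₂ → Adj z⁺ q₁ → Adj z p₂ → ⊥
          pred-succ = R.pred-succ (just h) (outside₁ h∉) (atD tp₁) (atD-suc i≢m tq₁) (atD tp₂) (atD-suc j≢m tq₂) lt

        module _ {i x a y} (tx : At P i x) (ta : At P (suc i) a) (ty : At P (suc (suc i)) y)
                 (za : Adj z a) (z⁺a : Adj z⁺ a) where

          private
            i≢m : i ≢ m
            i≢m eq = irr (subst (Adj z⁺) (At-det (subst (λ l → At P (suc l) a) eq ta) tz⁺) z⁺a)
            1+i≢m : suc i ≢ m
            1+i≢m eq = irr (subst (Adj z) (At-det (subst (λ l → At P l a) eq ta) tz) za)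
            ta′ : At D (suc (κ i)) (just a)
            ta′ = atD-suc i≢m ta
            ty′ : At D (suc (suc (κ i))) (just y)
            ty′ = subst (λ l → At D (suc l) (just y)) (rotated-suc (length P) m i≢m) (atD-suc 1+i≢m ty)

          move-single : Adj h x → Adj h y → ⊥
          move-single = R.move-single (just h) (outside₁ h∉) (atD tx) ta′ ty′ za z⁺a

          module _ {j p q} (tp : At P j p) (tq : At P (suc j) q) (j≢m : j ≢ m) (p≢x : p ≢ x) (p≢a : p ≢ a) where

            private
              κj≢ : κ j ≢ κ i
              κj≢ eq = p≢x (κ-inj tp tx eq)
              κj≢′ : κ j ≢ suc (κ i)
              κj≢′ eq = p≢a (just-injective (At-det (subst (λ l → At D l (just p)) eq (atD tp)) ta′))

            move-succ : Adj h x → Adj h p → Adj y q → ⊥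
            move-succ hx hp yq = R.move-succ (just h) (outside₁ h∉) (atD tx) ta′ ty′ za z⁺a (atD tp) (atD-suc j≢m tq) hx hp yq κj≢ κj≢′

            move-pred : Adj h y → Adj h q → Adj x p → ⊥
            move-pred hy hq xp = R.move-pred (just h) (outside₁ h∉) (atD tx) ta′ ty′ za z⁺a (atD tp) (atD-suc j≢m tq) hy hq xp κj≢ κj≢′

-- Arcs between consecutive marked elements of a list

module Arcs {A : Set} (X : A → Set) where

  -- x and y are marked, a follows x and w precedes y.
  record Arc (L : List A) : Set where
    constructor arc
    field
      {i e}     : ℕ
      {x a w y} : A
      at-x      : At L i x
      at-a      : At L (suc i) a
      at-w      : At L e w
      at-y      : At L (suc e) y
      i≤e       : i ≤ e
      Xx        : X x
      Xy        : X y

  open Arc public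

  shiftArc : ∀ {p L} → Arc L → Arc (p ∷ L)
  shiftArc (arc tx ta tw ty le Xx Xy) = arc (there tx) (there ta) (there tw) (there ty) (s≤s le) Xx Xy

  -- The indices carry the starting mark, so that each arc begins where the previous one ends. The
  -- closing `end` supplies the last mark; hence there is one mark more than there are arcs.
  data Chain (L : List A) : ℕ → A → List (Arc L) → Set where
    end  : ∀ {i x} → At L i x → X x → Chain L i x []
    link : ∀ α {αs} → Chain L (suc (e α)) (y α) αs → Chain L (i α) (x α) (α ∷ αs)

  shiftChain : ∀ {p L j x αs} → Chain L j x αs → Chain (p ∷ L) (suc j) x (map shiftArc αs)
  shiftChain (end t Xx) = end (there t) Xx
  shiftChain (link α c) = link (shiftArc α) (shiftChain c)

  start-at : ∀ {L j x αs} → Chain L j x αs → At L j x × X x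
  start-at (end t Xx) = t , Xx
  start-at (link α _) = at-x α , Xx α

  chain : (X? : Decidable X) → ∀ L →
    All (¬_ ∘ X) L ⊎ ∃₂ λ j x → ∃ λ αs → Chain L j x αs × count X? L ≡ suc (length αs)
  chain X? [] = inj₁ []
  chain X? (p ∷ L) with X? p | chain X? L
  ... | no ¬Xp | inj₁ none = inj₁ (¬Xp ∷ none)
  ... | no ¬Xp | inj₂ (j , x , αs , c , eq) =
    inj₂ (suc j , x , map shiftArc αs , shiftChain c , trans eq (cong suc (sym (length-map shiftArc αs))))
  ... | yes Xp | inj₁ none = inj₂ (0 , p , [] , end here Xp , cong suc (count-none X? L (All.lookup none)))
  ... | yes Xp | inj₂ (j , x , αs , c , eq) =
    let t , Xx = start-at c
        _ , ta = At-≤ t z≤n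
        _ , tw = At-≤ {xs = p ∷ L} (there t) (n≤1+n j)
    in inj₂ (0 , p , _ , link (arc here (there ta) tw (there t) z≤n Xp Xx) (shiftChain c) ,
             cong suc (trans eq (cong suc (sym (length-map shiftArc αs)))))

  chain-≥ : ∀ {L j x αs} → Chain L j x αs → All (λ α → j ≤ i α) αs
  chain-≥ (end _ _)  = []
  chain-≥ (link α c) = ≤-refl ∷ All.map (≤-trans (≤-trans (i≤e α) (n≤1+n (e α)))) (chain-≥ c)

  chain-sorted : ∀ {L j x αs} → Chain L j x αs → AllPairs (λ α β → e α < i β) αs
  chain-sorted (end _ _)  = []
  chain-sorted (link _ c) = chain-≥ c ∷ chain-sorted c

  module _ {L : List A} (uL : Unique L) {αs : List (Arc L)} (sorted : AllPairs (λ α β → e α < i β) αs) where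

    unique-a : Unique (map a αs)
    unique-a = AllPairsₚ.map⁺ (AllPairs.map (λ {α} {β} e<i a≡ →
      <⇒≢ (s≤s (≤-trans (s≤s (i≤e α)) e<i)) (At-inj uL (at-a α) (subst (At L (suc (i β))) (sym a≡) (at-a β)))) sorted)

    unique-w : Unique (map w αs)
    unique-w = AllPairsₚ.map⁺ (AllPairs.map (λ {α} {β} e<i w≡ →
      <⇒≢ (≤-trans e<i (i≤e β)) (At-inj uL (at-w α) (subst (At L (e β)) (sym w≡) (at-w β)))) sorted)

lookup-injective : ∀ {A : Set} {xs : List A} → Unique xs → ∀ {i j} → lookup xs i ≡ lookup xs j → i ≡ j
lookup-injective (_ ∷ _)  {zero}  {zero}  _  = refl
lookup-injective {xs = _ ∷ xs} (h ∷ _) {zero}  {suc j} eq = ⊥-elim (All.lookup h (∈-lookup {xs = xs} j) eq)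
lookup-injective {xs = _ ∷ xs} (h ∷ _) {suc i} {zero}  eq = ⊥-elim (All.lookup h (∈-lookup {xs = xs} i) (sym eq))
lookup-injective (_ ∷ u)  {suc i} {suc j} eq = cong suc (lookup-injective u eq)

-- Subsets given by decidable predicates

module _ {n : ℕ} {Q : Fin n → Set} (Q? : Decidable Q) where

  subset : Subset n
  subset = Vec.tabulate (λ v → does (Q? v))

  ∈-subset⁺ : ∀ {v} → Q v → v ∈ subset
  ∈-subset⁺ {v} q = Vecₚ.lookup⇒[]= v subset (trans (Vecₚ.lookup∘tabulate _ v) (dec-true (Q? v) q))

  ∈-subset⁻ : ∀ {v} → v ∈ subset → Q v
  ∈-subset⁻ {v} v∈ with Q? v | trans (sym (Vecₚ.lookup∘tabulate (λ v → does (Q? v)) v)) (Vecₚ.[]=⇒lookup v∈)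
  ... | yes q | _ = q
  ... | no _  | ()

  ∣subset∣ : ∣ subset ∣ ≡ count Q? (allFin n)
  ∣subset∣ = go (λ v → v)
    where
    go : ∀ {m} (f : Fin m → Fin n) → ∣ Vec.tabulate (λ i → does (Q? (f i))) ∣ ≡ count Q? (tabulate f)
    go {zero}  f = refl
    go {suc m} f with Q? (f zero)
    ... | yes _ = cong suc (go (f ∘ suc))
    ... | no _  = go (f ∘ suc)

  ∣subset∣≤ : ∀ {ys} → (∀ {v} → Q v → v ∈ˡ ys) → ∣ subset ∣ ≤ count Q? ys
  ∣subset∣≤ {ys} sub = ≤-trans (≤-reflexive ∣subset∣) (count-⊆ Q? (Uniq.allFin⁺ n) (λ _ → sub))

-- For a contradiction, finitely many propositions may be assumed decided. This is what allows
-- splitting on membership in a component, which is given only by the existence of a walk.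
¬¬-decide : ∀ {n} (Q : Fin n → Set) → ((∀ v → Dec (Q v)) → ⊥) → ⊥
¬¬-decide {zero}  Q k = k (λ ())
¬¬-decide {suc n} Q k = ¬¬-decide (Q ∘ suc) (λ ds → no-no (λ d → k (λ { zero → d ; (suc v) → ds v })))
  where
  no-no : (Dec (Q zero) → ⊥) → ⊥
  no-no k = k (no (λ q → k (yes q)))

-- Edges against independent sets in a graph without an induced K₂ ∪ kK₁

module Free {n : ℕ} (G : Graph n) (k : ℕ) (free : K2∪kK1-free G k) where
  open Graph G renaming (sym to adj-sym)

  IndependentList : List (Fin n) → Set
  IndependentList J = Unique J × (∀ {p q} → p ∈ˡ J → q ∈ˡ J → ¬ Adj p q)

  few-common-nonneighbours : ∀ {p q J} → Adj p q → IndependentList J →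
    (∀ {r} → r ∈ˡ J → ¬ Adj p r) → (∀ {r} → r ∈ˡ J → ¬ Adj q r) → length J < k
  few-common-nonneighbours {p} {q} {J} e (uJ , iJ) ¬p ¬q with k ≤? length J
  ... | no k≰  = ≰⇒> k≰
  ... | yes k≤ = ⊥-elim (free (p , q , f , e , (λ eq → Finₚ.inject≤-injective k≤ k≤ _ _ (lookup-injective uJ eq)) ,
                  (λ i eq → ¬q (f∈ i) (subst (Adj q) (sym eq) (adj-sym e))) ,
                  (λ i eq → ¬p (f∈ i) (subst (Adj p) (sym eq) e)) ,
                  (λ i → ¬p (f∈ i)) , (λ i → ¬q (f∈ i)) , λ i j → iJ (f∈ i) (f∈ j)))
    where
    f : Fin k → Fin n
    f i = lookup J (inject≤ i k≤)
    f∈ : ∀ i → f i ∈ˡ J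
    f∈ i = ∈-lookup {xs = J} (inject≤ i k≤)

  -- The elements of `J` missed by `z` are missed by `p` too, as `J` is independent; the edge z p
  -- leaves fewer than `k` of them.
  many-neighbours : ∀ {z p J} → IndependentList J → p ∈ˡ J → Adj z p → length J < count (adj? z) J + k
  many-neighbours {z} {p} {J} (uJ , iJ) p∈ e = ≤-trans (≤-reflexive eq) (+-monoʳ-≤ (count (adj? z) J) lt)
    where
    J′ : List (Fin n)
    J′ = filter (¬? ∘ adj? z) J
    J′⊆ : ∀ {r} → r ∈ˡ J′ → r ∈ˡ J × ¬ Adj z r
    J′⊆ = ∈-filter⁻ (¬? ∘ adj? z) {xs = J}
    lt : length J′ < k
    lt = few-common-nonneighbours e (Uniq.filter⁺ (¬? ∘ adj? z) uJ , (λ p∈ q∈ → iJ (proj₁ (J′⊆ p∈)) (proj₁ (J′⊆ q∈))))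
           (proj₂ ∘ J′⊆) (λ r∈ → iJ p∈ (proj₁ (J′⊆ r∈)))
    eq : suc (length J) ≡ count (adj? z) J + suc (length J′)
    eq = trans (cong suc (sym (count-¬ (adj? z) J))) (sym (+-suc _ _))

-- Walks

module _ {n : ℕ} (G : Graph n) where
  open Graph G renaming (sym to adj-sym)
  open Segments Adj
  open import Data.List.Membership.DecPropositional (Finₚ._≟_ {n}) using (_∈?_)

  walk-start : ∀ {S p q} → WalkAvoiding G S p q → p ∉ S
  walk-start (here p∉)     = p∉
  walk-start (step p∉ _ _) = p∉

  walk-trans : ∀ {S p q r} → WalkAvoiding G S p q → WalkAvoiding G S q r → WalkAvoiding G S p r
  walk-trans (here _)      w = w
  walk-trans (step p∉ e v) w = step p∉ e (walk-trans v w)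

  walk-sym : ∀ {S p q} → WalkAvoiding G S p q → WalkAvoiding G S q p
  walk-sym (here p∉)     = here p∉
  walk-sym (step p∉ e w) = walk-trans (walk-sym w) (step (walk-start w) (adj-sym e) (here p∉))

  from : ∀ {p q r L} → Seg p q L → Unique L → r ∈ˡ L → ∃ λ M → Seg r q M × Unique M × (∀ {s} → s ∈ˡ M → s ∈ˡ L)
  from s       u       (here refl) with Seg-head s here
  ... | refl = _ , s , u , λ s∈ → s∈
  from (_ ◂ s) (_ ∷ u) (there r∈) = let M , t , uM , sub = from s u r∈ in M , t , uM , there ∘ sub

  walk⇒path : ∀ {S p q} → WalkAvoiding G S p q → ∃ λ L → Seg p q L × Unique L × All (_∉ S) L
  walk⇒path (here p∉) = _ , one , ([] ∷ []) , p∉ ∷ []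
  walk⇒path {p = p} (step p∉ e w) with walk⇒path w
  ... | L , s , u , L∉ with p ∈? L
  ...   | yes p∈ = let M , t , uM , sub = from s u p∈ in M , t , uM , All.tabulate (All.lookup L∉ ∘ sub)
  ...   | no p∉L = _ , e ◂ s , All.tabulate (λ r∈ eq → p∉L (subst (_∈ˡ L) (sym eq) r∈)) ∷ u , p∉ ∷ L∉

-- The vertices off a longest path are independent

module OutsideIndependent {n : ℕ} (G : Graph n) (k : ℕ) (free : K2∪kK1-free G k) (u v : Fin n) (u≢v : u ≢ v)
  (P : List (Fin n)) (sP : Path G u v P) (uP : Unique P)
  (noLonger : ∀ {Q} → Path G u v Q → Unique Q → length P < length Q → ⊥) where

  open Graph G renaming (sym to adj-sym)
  open Free G k free
  open LongestPath G u v P sP uP noLonger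
  open import Data.List.Membership.DecPropositional (Finₚ._≟_ {n}) using (_∈?_)

  module _ (conn : KConnected G (suc k)) {h₀ h₁ : Fin n} (h₀∉ : h₀ ∉ˡ P) (h₁∉ : h₁ ∉ˡ P) (h₀~h₁ : Adj h₀ h₁) where

    PS : Subset n
    PS = subset (_∈? P)

    avoids : ∀ {p} → p ∉ PS → p ∉ˡ P
    avoids p∉ p∈ = p∉ (∈-subset⁺ (_∈? P) p∈)

    -- C is the component of G − P containing h₀.
    C : Fin n → Set
    C = WalkAvoiding G PS h₀

    C∉P : ∀ {y} → C y → y ∉ˡ P
    C∉P c = avoids (walk-start G (walk-sym G c))

    detour : ∀ {y y′} → C y → C y′ → Detour y y′
    detour c c′ = let K , s , uK , K∉ = walk⇒path G (walk-trans G (walk-sym G c) c′)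
                  in K , s , uK , All.map avoids K∉

    X : Fin n → Set
    X p = ∃ λ y → C y × Adj p y

    no-consecutive : ∀ {m z z⁺} → At P m z → At P (suc m) z⁺ → X z → X z⁺ → ⊥
    no-consecutive tz tz⁺ (y , c , e) (y′ , c′ , e′) = At-Cut.insert tz tz⁺ (detour c c′) e (adj-sym e′)

    module _ (C? : Decidable C) where

      X? : Decidable X
      X? p = Finₚ.any? (λ y → C? y ×-dec adj? p y)

      open Arcs X

      no-cross : ∀ (α β : Arc P) → i α ≢ i β → ¬ Adj (a α) (a β)
      no-cross α β i≢ e =
        let y  , c  , f  = Xx α
            y′ , c′ , f′ = Xx β
        in At-Cut.cross (at-x α) (at-a α) (detour c c′) (at-x β) (at-a β) (i≢ ∘ sym) f (adj-sym f′) e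

      -- The successors on `P` of all attachments but the last are independent and see nothing in
      -- `C`, so the edge between `h₀` and `h₁` allows fewer than `k` of them.
      few-attachments : count X? P ≤ k
      few-attachments with chain X? P
      ... | inj₁ none = ≤-trans (≤-reflexive (count-none X? P (All.lookup none))) z≤n
      ... | inj₂ (_ , _ , αs , ch , eq) = ≤-trans (≤-reflexive (trans eq (cong suc (sym (length-map a αs)))))
              (few-common-nonneighbours h₀~h₁ (unique-a uP (chain-sorted ch) , indep) (not-C h₀-C) (not-C h₁-C))
        where
        h₀-C : C h₀
        h₀-C = here (λ h∈ → h₀∉ (∈-subset⁻ (_∈? P) h∈))
        h₁-C : C h₁
        h₁-C = step (walk-start G h₀-C) h₀~h₁ (here (λ h∈ → h₁∉ (∈-subset⁻ (_∈? P) h∈)))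
        not-C : ∀ {y} → C y → ∀ {r} → r ∈ˡ map a αs → ¬ Adj y r
        not-C c r∈ e with ∈-map⁻ a r∈
        ... | α , _ , refl = no-consecutive (at-x α) (at-a α) (Xx α) (_ , c , adj-sym e)
        indep : ∀ {p q} → p ∈ˡ map a αs → q ∈ˡ map a αs → ¬ Adj p q
        indep p∈ q∈ e with ∈-map⁻ a p∈ | ∈-map⁻ a q∈
        ... | α , _ , refl | β , _ , refl with i α ≟ i β
        ...   | no i≢ = no-cross α β i≢ e
        ...   | yes i≡ = irr (subst (λ p → Adj p (a β)) (At-det (subst (λ j → At P (suc j) (a α)) i≡ (at-a α)) (at-a β)) e)

      -- `X` also holds at vertices inside `C`; only its part on `P` separates `C` from the rest.
      XP? : Decidable (λ p → p ∈ˡ P × X p)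
      XP? p = (p ∈? P) ×-dec X? p

      separator : Subset n
      separator = subset XP?

      |separator| : ∣ separator ∣ < suc k
      |separator| = s≤s (≤-trans (∣subset∣≤ XP? proj₁) (≤-trans (sumOver-mono P (λ {p} _ → mono p)) few-attachments))
        where
        mono : ∀ p → ind (XP? p) ≤ ind (X? p)
        mono p with XP? p
        ... | no _ = z≤n
        ... | yes (_ , Xp) = ≤-reflexive (sym (ind-yes (X? p) Xp))

      trapped : ∀ {p q} → C p → q ∈ˡ P → ¬ WalkAvoiding G separator p q
      trapped c q∈ (here _) = C∉P c q∈
      trapped c q∈ (step {w = w} p∉ e wk) with w ∈? P
      ... | yes w∈ = walk-start G wk (∈-subset⁺ XP? (w∈ , _ , c , adj-sym e))
      ... | no w∉  = trapped (walk-trans G c (step (avoid-P c) e (here (λ w∈ → w∉ (∈-subset⁻ (_∈? P) w∈))))) q∈ wk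
        where
        avoid-P : ∀ {p} → C p → p ∉ PS
        avoid-P c = walk-start G (walk-sym G c)

      -- An unattached vertex of `P` would be cut off from `h₀` by at most `k` vertices, against (k
      -- + 1)-connectivity.
      everything-attached : ∀ {q} → q ∈ˡ P → X q
      everything-attached {q} q∈ with X? q
      ... | yes Xq = Xq
      ... | no ¬Xq = ⊥-elim (trapped (here (λ h∈ → h₀∉ (∈-subset⁻ (_∈? P) h∈))) q∈
              (proj₂ conn separator |separator| h₀ q (h₀∉ ∘ proj₁ ∘ ∈-subset⁻ XP?) (¬Xq ∘ proj₂ ∘ ∈-subset⁻ XP?)))

      -- As `u ≢ v`, the path has two initial vertices; both are attached, and a detour through `C`
      -- fits between them.
      contradiction : ⊥
      contradiction with Segments.final Adj sP
      ... | zero  , t , _ = u≢v (sym (Segments.Seg-head Adj sP t))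
      ... | suc j , t , _ = let _ , t₁ = At-≤ t (s≤s z≤n) ; t₀ = Segments.first Adj sP
                            in no-consecutive t₀ t₁ (everything-attached (At⇒∈ t₀)) (everything-attached (At⇒∈ t₁))

    outside-edge-absurd : ⊥
    outside-edge-absurd = ¬¬-decide C contradiction

two-of-three : ∀ {A B C : Set} (a? : Dec A) (b? : Dec B) (c? : Dec C) →
  2 ≤ ind a? + (ind b? + (ind c? + 0)) → A × B ⊎ A × C ⊎ B × C
two-of-three (yes a) (yes b) _       _ = inj₁ (a , b)
two-of-three (yes a) (no _)  (yes c) _ = inj₂ (inj₁ (a , c))
two-of-three (no _)  (yes b) (yes c) _ = inj₂ (inj₂ (b , c))
two-of-three (yes _) (no _)  (no _)  (s≤s ())
two-of-three (no _)  (yes _) (no _)  (s≤s ())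
two-of-three (no _)  (no _)  (yes _) (s≤s ())
two-of-three (no _)  (no _)  (no _)  ()

module _ {A B C : Set} where

  without-first : ¬ A → A × B ⊎ A × C ⊎ B × C → B × C
  without-first ¬a (inj₁ (a , _))        = ⊥-elim (¬a a)
  without-first ¬a (inj₂ (inj₁ (a , _))) = ⊥-elim (¬a a)
  without-first ¬a (inj₂ (inj₂ bc))      = bc

  without-second : ¬ B → A × B ⊎ A × C ⊎ B × C → A × C
  without-second ¬b (inj₁ (_ , b))        = ⊥-elim (¬b b)
  without-second ¬b (inj₂ (inj₁ ac))      = ac
  without-second ¬b (inj₂ (inj₂ (b , _))) = ⊥-elim (¬b b)

  without-third : ¬ C → A × B ⊎ A × C ⊎ B × C → A × B
  without-third ¬c (inj₁ ab)             = ab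
  without-third ¬c (inj₂ (inj₁ (_ , c))) = ⊥-elim (¬c c)
  without-third ¬c (inj₂ (inj₂ (_ , c))) = ⊥-elim (¬c c)

-- `O` will say that an arc contains the edge z z⁺. Only there may `A` hold beside `B` or `C`, while
-- `B` and `C` always exclude each other.
three-exclusive : ∀ {A B C O : Set} (a? : Dec A) (b? : Dec B) (c? : Dec C) (o? : Dec O) →
  (B → C → ⊥) → (¬ O → A → B → ⊥) → (¬ O → A → C → ⊥) →
  ind a? + ind b? + ind c? ≤ suc (ind o?)
three-exclusive (no _)  (yes b) (yes c) _       bc _  _  = ⊥-elim (bc b c)
three-exclusive (no _)  (yes _) (no _)  _       _  _  _  = s≤s z≤n
three-exclusive (no _)  (no _)  c?      _       _  _  _  = ≤-trans (ind≤1 c?) (s≤s z≤n)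
three-exclusive (yes _) (yes b) (yes c) _       bc _  _  = ⊥-elim (bc b c)
three-exclusive (yes _) (yes _) (no _)  (yes _) _  _  _  = ≤-refl
three-exclusive (yes a) (yes b) (no _)  (no ¬o) _  ab _  = ⊥-elim (ab ¬o a b)
three-exclusive (yes _) (no _)  (yes _) (yes _) _  _  _  = ≤-refl
three-exclusive (yes a) (no _)  (yes c) (no ¬o) _  _  ac = ⊥-elim (ac ¬o a c)
three-exclusive (yes _) (no _)  (no _)  _       _  _  _  = s≤s z≤n

sumOver-3 : ∀ {A : Set} (f g h : A → ℕ) xs →
  sumOver (λ x → f x + g x + h x) xs ≡ sumOver f xs + sumOver g xs + sumOver h xs
sumOver-3 f g h xs = trans (sumOver-+ (λ x → f x + g x) h xs) (cong (_+ sumOver h xs) (sumOver-+ f g xs))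

-- The two independent sets belonging to an outside vertex

module Config {n : ℕ} (G : Graph n) (k : ℕ) (free : K2∪kK1-free G k) (u v : Fin n)
  (P : List (Fin n)) (sP : Path G u v P) (uP : Unique P)
  (noLonger : ∀ {Q} → Path G u v Q → Unique Q → length P < length Q → ⊥)
  (outside-independent : ∀ {p q} → p ∉ˡ P → q ∉ˡ P → ¬ Graph.Adj G p q)
  (h : Fin n) (h∉P : h ∉ˡ P)
  {j₀ : ℕ} {x₀ : Fin n} {αs : List (Arcs.Arc (Graph.Adj G h) P)} (ch : Arcs.Chain (Graph.Adj G h) P j₀ x₀ αs)
  -- φ is the excess over `k` of the number of neighbours of `h` on `P`. The bound on `k` is the
  -- degree condition at `h`, and φ + 1 becomes the least number of elements of `J` seen by a vertex
  -- that sees any.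
  (φ : ℕ) (1≤φ : 1 ≤ φ) (|αs| : suc (length αs) ≡ φ + k) (k≤1+2φ : k ≤ suc (φ + φ))
  where

  open Graph G renaming (sym to adj-sym)
  open Free G k free public
  open LongestPath G u v P sP uP noLonger public
  open Arcs (Adj h) public

  adj⇒≢ : ∀ {p q} → Adj p q → p ≢ q
  adj⇒≢ e refl = irr e

  sorted : AllPairs (λ α β → e α < i β) αs
  sorted = chain-sorted ch

  detour-h : Detour h h
  detour-h = h ∷ [] , Segments.one , ([] ∷ []) , h∉P ∷ []

  consecutive-h : ∀ {m z z⁺} → At P m z → At P (suc m) z⁺ → Adj h z → ¬ Adj h z⁺
  consecutive-h tz tz⁺ hz hz⁺ = At-Cut.insert tz tz⁺ detour-h (adj-sym hz) hz⁺

  h≁a : ∀ (α : Arc P) → ¬ Adj h (a α)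
  h≁a α = consecutive-h (at-x α) (at-a α) (Xx α)

  h≁w : ∀ (α : Arc P) → ¬ Adj h (w α)
  h≁w α hw = consecutive-h (at-w α) (at-y α) hw (Xy α)

  -- Equality would make `a α` the vertex `y α`, a neighbour of `h` directly after another one.
  i<e : ∀ (α : Arc P) → i α < e α
  i<e α = ≤∧≢⇒< (i≤e α) λ i≡e → h≁a α (subst (Adj h) (At-det (at-y α) (subst (λ j → At P (suc j) (a α)) i≡e (at-a α))) (Xy α))

  same-a : ∀ (α β : Arc P) → x β ≡ x α → a α ≡ a β
  same-a α β x≡ = At-det (at-a α) (subst (λ j → At P (suc j) (a β))
    (At-inj uP (at-x β) (subst (At P (i α)) (sym x≡) (at-x α))) (at-a β))

  module _ {m z z⁺} (tz : At P m z) (tz⁺ : At P (suc m) z⁺) where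
    a≢z⁺⇒ : ∀ (α : Arc P) → a α ≢ z⁺ → i α ≢ m
    a≢z⁺⇒ α a≢ i≡m = a≢ (At-det (subst (λ j → At P (suc j) (a α)) i≡m (at-a α)) tz⁺)

    w≢z⇒ : ∀ (α : Arc P) → w α ≢ z → e α ≢ m
    w≢z⇒ α w≢ e≡m = w≢ (At-det (subst (λ j → At P j (w α)) e≡m (at-w α)) tz)

    -- Otherwise `h` joins `z` to `x α`, and the edge from `z⁺` to `a α` repairs the path. For `z`
    -- running over the `x β` this is the independence of the first vertices.
    after-h : Adj h z → ∀ (α : Arc P) → ¬ Adj z⁺ (a α)
    after-h hz α f = At-Cut.cross tz tz⁺ detour-h (at-x α) (at-a α) (a≢z⁺⇒ α (adj⇒≢ (adj-sym f))) (adj-sym hz) (Xx α) f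

    before-h : Adj h z⁺ → ∀ (α : Arc P) → ¬ Adj z (w α)
    before-h hz⁺ α f = At-Cut.Through.cross′ tz tz⁺ h∉P (at-w α) (at-y α) (w≢z⇒ α (adj⇒≢ (adj-sym f))) hz⁺ (Xy α) f

  a≁a : ∀ (α β : Arc P) → ¬ Adj (a α) (a β)
  a≁a α β = after-h (at-x α) (at-a α) (Xx α) β

  w≁w : ∀ (α β : Arc P) → ¬ Adj (w α) (w β)
  w≁w α β = before-h (at-w α) (at-y α) (Xy α) β

  -- The common theory of the two independent sets formed by the first,
  -- respectively the last, inner vertices of the arcs.
  module Side (b : Arc P → Fin n) (unique-b : Unique (map b αs))
    (b≁b : ∀ α β → ¬ Adj (b α) (b β)) (h≁b : ∀ α → ¬ Adj h (b α)) (b∈P : ∀ α → b α ∈ˡ P) where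

    Has : Fin n → Set
    Has z = Any (λ α → Adj z (b α)) αs

    Has? : Decidable Has
    Has? z = Any.any? (λ α → adj? z (b α)) αs

    c : Fin n → ℕ
    c z = count (λ α → adj? z (b α)) αs

    J : List (Fin n)
    J = h ∷ map b αs

    J-independent : IndependentList J
    J-independent = (All.tabulate (λ r∈ eq → h∉J (subst (_∈ˡ map b αs) (sym eq) r∈)) ∷ unique-b) , indep
      where
      h∉J : h ∉ˡ map b αs
      h∉J h∈ with ∈-map⁻ b h∈
      ... | α , _ , eq = h∉P (subst (_∈ˡ P) (sym eq) (b∈P α))
      indep : ∀ {p q} → p ∈ˡ J → q ∈ˡ J → ¬ Adj p q
      indep (here refl) (here refl) = irr
      indep (here refl) (there q∈) with ∈-map⁻ b q∈
      ... | β , _ , refl = h≁b β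
      indep (there p∈) (here refl) with ∈-map⁻ b p∈
      ... | α , _ , refl = h≁b α ∘ adj-sym
      indep (there p∈) (there q∈) with ∈-map⁻ b p∈ | ∈-map⁻ b q∈
      ... | α , _ , refl | β , _ , refl = b≁b α β

    -- `J` has φ + k elements, and fewer than `k` of them are missed by a vertex that sees one.
    many : ∀ {z p} → p ∈ˡ J → Adj z p → suc φ ≤ ind (adj? z h) + c z
    many {z} p∈ f = subst (λ t → suc φ ≤ ind (adj? z h) + t) (sumOver-map (ind ∘ adj? z) b αs)
      (+-cancelʳ-≤ k _ _ (≤-trans (≤-reflexive (cong suc (trans (sym |αs|) (cong suc (sym (length-map b αs))))))
                                  (many-neighbours J-independent p∈ f)))

    many-h : ∀ {z} → Adj h z → φ ≤ c z
    many-h {z} hz = ≤-pred (≤-trans (many (here refl) (adj-sym hz)) (+-monoˡ-≤ (c z) (ind≤1 (adj? z h))))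

    many-¬h : ∀ {z} → ¬ Adj h z → Has z → suc φ ≤ c z
    many-¬h {z} ¬hz has with find has
    ... | α , α∈ , f with adj? z h | many (there (∈-map⁺ b α∈)) f
    ... | yes zh | _ = ⊥-elim (¬hz (adj-sym zh))
    ... | no _   | p = p

    some : ∀ {z} → Has z → φ ≤ c z
    some {z} has with adj? h z
    ... | yes hz = many-h hz
    ... | no ¬hz = ≤-trans (n≤1+n φ) (many-¬h ¬hz has)

    has-h : ∀ {z} → Adj h z → Has z
    has-h hz = count-any _ αs (≤-trans 1≤φ (many-h hz))

    ¬Has-h : ¬ Has h
    ¬Has-h has = let α , _ , f = find has in h≁b α f

    ¬Has-b : ∀ α → ¬ Has (b α)
    ¬Has-b α has = let β , _ , f = find has in b≁b α β f

    -- Every neighbour of `h` sees the set because φ ≥ 1. So `p` and `q` miss `h` as well, and an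
    -- edge between them would have all φ + k ≥ k elements of `J` as common nonneighbours.
    empty-independent : ∀ {p q} → ¬ Has p → ¬ Has q → ¬ Adj p q
    empty-independent {p} {q} ¬p ¬q f = <⇒≱ lt (≤-trans (m≤n+m k φ) (≤-reflexive (trans (sym |αs|) (cong suc (sym (length-map b αs))))))
      where
      not : ∀ {r} → ¬ Has r → ∀ {s} → s ∈ˡ map b αs → ¬ Adj r s
      not ¬r s∈ g with ∈-map⁻ b s∈
      ... | α , α∈ , refl = ¬r (lose α∈ g)
      p≁h : ¬ Adj p h
      p≁h ph = ¬p (has-h (adj-sym ph))
      q≁h : ¬ Adj q h
      q≁h qh = ¬q (has-h (adj-sym qh))
      lt : length J < k
      lt = few-common-nonneighbours f J-independent
             (λ { (here refl) → p≁h ; (there s∈) → not ¬p s∈ })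
             (λ { (here refl) → q≁h ; (there s∈) → not ¬q s∈ })

  module First = Side a (unique-a uP sorted) a≁a h≁a (At⇒∈ ∘ at-a)
  module Last = Side w (unique-w uP sorted) w≁w h≁w (At⇒∈ ∘ at-w)

  -- At most one arc has index `j`, so one of any two neighbours survives. It supplies the second
  -- neighbour that an exchange needs away from a given arc.
  two-distinct : ∀ {b : Arc P → Fin n} {z} (idx : Arc P → ℕ) → AllPairs (λ α β → idx α ≢ idx β) αs →
    2 ≤ count (λ α → adj? z (b α)) αs → ∀ j → ∃ λ β → β ∈ˡ αs × Adj z (b β) × idx β ≢ j
  two-distinct {b} {z} idx distinct 2≤ j with Any.any? (λ β → adj? z (b β) ×-dec ¬? (idx β ≟ j)) αs
  ... | yes found = find found
  ... | no none = ⊥-elim (<⇒≱ 2≤ (≤-trans (sumOver-mono αs le) (count-atMostOne (λ β → idx β ≟ j) (AllPairs.map (λ d p q → d (trans p (sym q))) distinct))))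
    where
    le : ∀ {β} → β ∈ˡ αs → ind (adj? z (b β)) ≤ ind (idx β ≟ j)
    le {β} β∈ with adj? z (b β)
    ... | no _ = z≤n
    ... | yes f = ≤-reflexive (sym (ind-yes (idx β ≟ j) (decidable-stable (idx β ≟ j) (λ d → none (lose β∈ (f , d))))))

  distinct-i : AllPairs (λ α β → i α ≢ i β) αs
  distinct-i = AllPairs.map (λ {α} e<i → <⇒≢ (<-trans (i<e α) e<i)) sorted

  distinct-e : AllPairs (λ α β → e α ≢ e β) αs
  distinct-e = AllPairs.map (λ {α} {β} e<i → <⇒≢ (<-trans e<i (i<e β))) sorted

  -- The central inequality: 3φ + 2 exceeds φ + k, as k ≤ 2φ + 1.
  3φ-bound : ∀ {a b c} → suc φ ≤ a → φ ≤ b → suc φ ≤ c → a + b + c ≤ suc (length αs) → ⊥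
  3φ-bound {a} {b} {c} a≥ b≥ c≥ le = <⇒≱ (n<1+n (suc (φ + (φ + φ)))) (begin
    suc (suc (φ + (φ + φ))) ≡⟨ cong (2 +_) (sym (+-assoc φ φ φ)) ⟩
    suc (suc (φ + φ + φ))   ≡⟨ cong suc (sym (+-suc (φ + φ) φ)) ⟩
    suc φ + φ + suc φ       ≤⟨ +-mono-≤ (+-mono-≤ a≥ b≥) c≥ ⟩
    a + b + c               ≤⟨ le ⟩
    suc (length αs)         ≡⟨ |αs| ⟩
    φ + k                   ≤⟨ +-monoʳ-≤ φ k≤1+2φ ⟩
    φ + suc (φ + φ)         ≡⟨ +-suc φ (φ + φ) ⟩
    suc (φ + (φ + φ))       ∎)
    where open ≤-Reasoning

  -- What two consecutive vertices of the path can see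

  module Pair {m z z⁺} (tz : At P m z) (tz⁺ : At P (suc m) z⁺) where

    κ : ℕ → ℕ
    κ = rotated (length P) m

    z~z⁺ : Adj z z⁺
    z~z⁺ = At-Cut.z~z⁺ tz tz⁺

    private
      κ-inj : ∀ {i j p q} → At P i p → At P j q → κ i ≡ κ j → p ≡ q
      κ-inj = At-Cut.κ-inj tz tz⁺
      module T = At-Cut.Through tz tz⁺ h∉P

      i≢m : ∀ α → a α ≢ z⁺ → i α ≢ m
      i≢m = a≢z⁺⇒ tz tz⁺
      e≢m : ∀ α → w α ≢ z → e α ≢ m
      e≢m = w≢z⇒ tz tz⁺
      i≢m⁺ : ∀ α → Adj z⁺ (a α) → i α ≢ m
      i≢m⁺ α f = i≢m α (λ eq → adj⇒≢ f (sym eq))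
      e≢m⁻ : ∀ α → Adj z (w α) → e α ≢ m
      e≢m⁻ α f = e≢m α (λ eq → adj⇒≢ f (sym eq))

    -- Makes the orders below strict: `x α` is a neighbour of `h` and `w β` is not.
    κe≢κi : ∀ (α β : Arc P) → κ (e β) ≢ κ (i α)
    κe≢κi α β eq = h≁w β (subst (Adj h) (sym (κ-inj (at-w β) (at-x α) eq)) (Xx α))

    succ-after-pred : ∀ (α β : Arc P) → Adj z⁺ (a α) → Adj z (w β) → κ (e β) < κ (i α)
    succ-after-pred α β f g = ≤∧≢⇒< (≮⇒≥ λ lt →
      T.pred-succ (at-x α) (at-a α) (i≢m⁺ α f) (at-w β) (at-y β) (e≢m⁻ β g) lt (Xx α) (Xy β) f g)
      (κe≢κi α β)

    -- The order with the roles of `z` and `z⁺` exchanged. Since `z` may see `z⁺` itself, adjacency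
    -- no longer excludes `a α ≡ z⁺` or `w β ≡ z`.
    succ-after-pred′ : ∀ (α β : Arc P) → a α ≢ z⁺ → w β ≢ z → Adj z (a α) → Adj z⁺ (w β) → κ (e β) < κ (i α)
    succ-after-pred′ α β a≢ w≢ f g = ≤∧≢⇒< (≮⇒≥ λ lt →
      T.succ-pred (at-x α) (at-a α) (i≢m α a≢) (at-w β) (at-y β) (e≢m β w≢) lt (Xx α) (Xy β) f g)
      (κe≢κi α β)

    -- Otherwise `a α` moves between `z` and `z⁺`, leaving a gap from `x α` to the vertex `y′` after
    -- `a α`. Either `h` fills the gap directly, or `y′` sees a second first vertex `a β` and `h`
    -- joins `x α` to `x β`.
    not-both-a : ∀ (α : Arc P) → α ∈ˡ αs → Adj z (a α) → Adj z⁺ (a α) → ⊥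
    not-both-a α α∈ f f⁺ with At-≤ (at-y α) (s≤s (i<e α))
    ... | y′ , ty′ with adj? h y′
    ...   | yes hy′ = T.move-single (at-x α) (at-a α) ty′ f f⁺ (Xx α) hy′
    ...   | no ¬hy′ =
      let has = lose α∈ (adj-sym (At-Cut.z~z⁺ (at-a α) ty′))
          β , β∈ , g , i≢ = two-distinct {a} i distinct-i (≤-trans (s≤s 1≤φ) (First.many-¬h ¬hy′ has)) (i α)
      in T.move-succ (at-x α) (at-a α) ty′ f f⁺ (at-x β) (at-a β)
           (i≢m β (λ eq → a≁a β α (subst (λ p → Adj p (a α)) (sym eq) f⁺)))
           (λ eq → i≢ (At-inj uP (at-x β) (subst (At P (i α)) (sym eq) (at-x α))))
           (λ eq → h≁a α (subst (Adj h) eq (Xx β)))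
           (Xx α) (Xx β) g

    not-both-w : ∀ (α : Arc P) → α ∈ˡ αs → Adj z (w α) → Adj z⁺ (w α) → ⊥
    not-both-w α α∈ f f⁺ with e α in eq-e | i<e α
    ... | suc e′ | _ with At-≤ (at-w α) (≤-trans (n≤1+n e′) (≤-reflexive (sym eq-e)))
    ...   | x′ , tx′ = go (adj? h x′)
      where
      tw : At P (suc e′) (w α)
      tw = subst (λ j → At P j (w α)) eq-e (at-w α)
      ty : At P (suc (suc e′)) (y α)
      ty = subst (λ j → At P (suc j) (y α)) eq-e (at-y α)
      has : Last.Has x′
      has = lose α∈ (At-Cut.z~z⁺ tx′ tw)
      go : Dec (Adj h x′) → ⊥
      go (yes hx′) = T.move-single tx′ tw ty f f⁺ hx′ (Xy α)
      go (no ¬hx′) =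
        let β , β∈ , g , e≢ = two-distinct {w} e distinct-e (≤-trans (s≤s 1≤φ) (Last.many-¬h ¬hx′ has)) (e α)
        in T.move-pred tx′ tw ty f f⁺ (at-w β) (at-y β)
             (e≢m β (λ eq → w≁w β α (subst (λ p → Adj p (w α)) (sym eq) f)))
             (λ eq → adj⇒≢ g (sym eq))
             (λ eq → e≢ (At-inj uP (at-w β) (subst (At P (e α)) (sym eq) (at-w α))))
             (Xy α) (Xy β) g

    succ-order : ∀ (α β : Arc P) → β ∈ˡ αs → a α ≢ z⁺ → Adj z (a α) → Adj z⁺ (a β) → κ (i β) < κ (i α)
    succ-order α β β∈ a≢ f g = ≤∧≢⇒< (≮⇒≥ λ lt →
      T.succ-succ (at-x α) (at-a α) (i≢m α a≢) (at-x β) (at-a β) (i≢m⁺ β g) lt (Xx α) (Xx β) f g)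
      λ eq → not-both-a β β∈ (subst (Adj z) (same-a α β (κ-inj (at-x β) (at-x α) eq)) f) g

    pred-order : ∀ (α β : Arc P) → β ∈ˡ αs → w β ≢ z → Adj z (w α) → Adj z⁺ (w β) → κ (e β) < κ (e α)
    pred-order α β β∈ w≢ f g = ≤∧≢⇒< (≮⇒≥ λ lt →
      T.pred-pred (at-w α) (at-y α) (e≢m⁻ α f) (at-w β) (at-y β) (e≢m β w≢) lt (Xy α) (Xy β) f g)
      λ eq → not-both-w β β∈ (subst (Adj z) (sym (κ-inj (at-w β) (at-w α) eq)) f) g

    -- The edge z z⁺ lies between `a α` and `w α`. Cutting there puts `w α` before `x α` in the
    -- cyclic order, the reverse of what `inside` gives for other arcs.
    Own : Arc P → Set
    Own α = i α < m × m < e α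

    Own? : Decidable Own
    Own? α = (suc (i α) ≤? m) ×-dec (suc m ≤? e α)

    own≤1 : count Own? αs ≤ 1
    own≤1 = count-atMostOne Own? (AllPairs.map (λ e<i p q → <-asym (<-trans (proj₂ p) e<i) (proj₁ q)) sorted)

    inside : ∀ α → ¬ Own α → i α ≢ m → e α ≢ m → κ (i α) < κ (e α)
    inside α ¬own i≢ e≢ = rotated-< (length P) m (i<e α) side
      where
      side : e α ≤ m ⊎ m < i α
      side with e α ≤? m
      ... | yes e≤m = inj₁ e≤m
      ... | no e≰m  = inj₂ (≤∧≢⇒< (≮⇒≥ (λ i<m → ¬own (i<m , ≰⇒> e≰m))) (i≢ ∘ sym))

    inside′ : ∀ α → ¬ Own α → a α ≢ z⁺ → w α ≢ z → κ (i α) < κ (e α)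
    inside′ α ¬own a≢ w≢ = inside α ¬own (a≢z⁺⇒ tz tz⁺ α a≢) (w≢z⇒ tz tz⁺ α w≢)

    -- Each arc pays for one incidence and the own arc for two. As own arcs are unique, the total
    -- exceeds the number of arcs by at most one.
    sum-with-own : ∀ {f g l : Arc P → ℕ} → (∀ {α} → α ∈ˡ αs → f α + g α + l α ≤ suc (ind (Own? α))) →
      sumOver f αs + sumOver g αs + sumOver l αs ≤ suc (length αs)
    sum-with-own {f} {g} {l} le = begin
      sumOver f αs + sumOver g αs + sumOver l αs ≡⟨ sumOver-3 f g l αs ⟨
      sumOver (λ α → f α + g α + l α) αs         ≤⟨ sumOver-mono αs le ⟩
      sumOver (λ α → 1 + ind (Own? α)) αs        ≡⟨ sumOver-+ (λ _ → 1) (ind ∘ Own?) αs ⟩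
      sumOver (λ _ → 1) αs + count Own? αs       ≤⟨ +-mono-≤ (≤-reflexive (sumOver-const1 αs)) own≤1 ⟩
      length αs + 1                              ≡⟨ +-comm (length αs) 1 ⟩
      suc (length αs)                            ∎
      where open ≤-Reasoning

    a≢z⁺ : First.Has z⁺ → ∀ α → a α ≢ z⁺
    a≢z⁺ fz⁺ α eq = First.¬Has-b α (subst First.Has (sym eq) fz⁺)

    w≢z : Last.Has z → ∀ α → w α ≢ z
    w≢z gz α eq = Last.¬Has-b α (subst Last.Has (sym eq) gz)

    z≁h : First.Has z⁺ → ¬ Adj h z
    z≁h fz⁺ hz = let α , _ , f = find fz⁺ in after-h tz tz⁺ hz α f

    z⁺≁h : Last.Has z → ¬ Adj h z⁺
    z⁺≁h gz hz⁺ = let α , _ , f = find gz in before-h tz tz⁺ hz⁺ α f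

    -- In cyclic order the last vertices seen by `z` come first, then the first vertices seen by
    -- `z⁺`, then the first vertices seen by `z`. These three intervals share at most the own arc
    -- and hold at least 3φ + 2 elements.
    exclude-F : Last.Has z → First.Has z⁺ → ¬ First.Has z
    exclude-F gz fz⁺ fz = 3φ-bound (Last.many-¬h (z≁h fz⁺) gz) (First.some fz⁺) (First.many-¬h (z≁h fz⁺) fz)
      (sum-with-own (λ {α} α∈ → three-exclusive (adj? z (w α)) (adj? z⁺ (a α)) (adj? z (a α)) (Own? α)
        (λ f⁺ f → not-both-a α α∈ f f⁺)
        (λ ¬own g f⁺ → <-asym (succ-after-pred α α f⁺ g) (inside′ α ¬own (a≢z⁺ fz⁺ α) (w≢z gz α)))
        (λ ¬own g f → let β , β∈ , f⁺ = find fz⁺ in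
          <-asym (<-trans (succ-after-pred β α f⁺ g) (succ-order α β β∈ (a≢z⁺ fz⁺ α) f f⁺))
                 (inside′ α ¬own (a≢z⁺ fz⁺ α) (w≢z gz α)))))

    -- Here the intervals are, in order, the last vertices seen by `z⁺`, the last vertices seen by
    -- `z`, and the first vertices seen by `z⁺`.
    exclude-W : Last.Has z → First.Has z⁺ → ¬ Last.Has z⁺
    exclude-W gz fz⁺ gz⁺ = 3φ-bound (First.many-¬h (z⁺≁h gz) fz⁺) (Last.some gz) (Last.many-¬h (z⁺≁h gz) gz⁺)
      (sum-with-own (λ {α} α∈ → three-exclusive (adj? z⁺ (a α)) (adj? z (w α)) (adj? z⁺ (w α)) (Own? α)
        (λ g g⁺ → not-both-w α α∈ g g⁺)
        (λ ¬own f⁺ g → <-asym (succ-after-pred α α f⁺ g) (inside′ α ¬own (a≢z⁺ fz⁺ α) (w≢z gz α)))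
        (λ ¬own f⁺ g⁺ → let β , β∈ , g = find gz in
          <-asym (<-trans (pred-order β α α∈ (w≢z gz α) g g⁺) (succ-after-pred α β f⁺ g))
                 (inside′ α ¬own (a≢z⁺ fz⁺ α) (w≢z gz α)))))

    cover-F : ¬ First.Has z → First.Has z⁺
    cover-F ¬fz = decidable-stable (First.Has? z⁺) (λ ¬fz⁺ → First.empty-independent ¬fz ¬fz⁺ z~z⁺)

    cover-W : ¬ Last.Has z → Last.Has z⁺
    cover-W ¬gz = decidable-stable (Last.Has? z⁺) (λ ¬gz⁺ → Last.empty-independent ¬gz ¬gz⁺ z~z⁺)

    cover-W⁻ : ¬ Last.Has z⁺ → Last.Has z
    cover-W⁻ ¬gz⁺ = decidable-stable (Last.Has? z) (λ ¬gz → ¬gz⁺ (cover-W ¬gz))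

  -- Outside vertices see neither set; the count against independent sets of size n/2

  outside-¬F : ∀ {r} → r ∉ˡ P → ¬ First.Has r
  outside-¬F {r} r∉ fr with r Finₚ.≟ h
  ... | yes refl = First.¬Has-h fr
  ... | no r≢h =
    -- As `r` misses `h`, it sees a second first vertex `a β`. Then `r` bridges `a α` and `a β`
    -- while `h` bridges `x α` and `x β`, and both are absorbed.
    let α , _ , f = find fr
        β , _ , g , i≢ = two-distinct {a} i distinct-i (≤-trans (s≤s 1≤φ) (First.many-¬h (outside-independent h∉P r∉) fr)) (i α)
    in At-Cut.Through.crossVia (at-x α) (at-a α) h∉P (at-x β) (at-a β) i≢ r∉ r≢h (Xx α) (Xx β) f g

  outside-¬W : ∀ {r} → r ∉ˡ P → ¬ Last.Has r
  outside-¬W {r} r∉ gr with r Finₚ.≟ h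
  ... | yes refl = Last.¬Has-h gr
  ... | no r≢h =
    let α , _ , f = find gr
        β , _ , g , e≢ = two-distinct {w} e distinct-e (≤-trans (s≤s 1≤φ) (Last.many-¬h (outside-independent h∉P r∉) gr)) (e α)
    in At-Cut.Through.crossVia′ (at-w α) (at-y α) h∉P (at-w β) (at-y β) e≢ r∉ r≢h (Xy α) (Xy β) f g

  Both Neither : Fin n → Set
  Both z    = First.Has z × Last.Has z
  Neither z = ¬ First.Has z × ¬ Last.Has z

  Both? : Decidable Both
  Both? z = First.Has? z ×-dec Last.Has? z

  Neither? : Decidable Neither
  Neither? z = ¬? (First.Has? z) ×-dec ¬? (Last.Has? z)

  -- Inclusion-exclusion in a form that sums to: nonseers of the first set, plus nonseers of the
  -- second, plus `Both`, equal n plus `Neither`.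
  four-kinds : ∀ z → ind (¬? (First.Has? z)) + ind (¬? (Last.Has? z)) + ind (Both? z) ≡ suc (ind (Neither? z))
  four-kinds z with First.Has? z | Last.Has? z
  ... | yes _ | yes _ = refl
  ... | yes _ | no _  = refl
  ... | no _  | yes _ = refl
  ... | no _  | no _  = refl

  module _ (stuck : ∀ {m z z⁺} → At P m z → At P (suc m) z⁺ → Last.Has z → First.Has z) where

    -- All that is kept of `L` being a suffix of `P`: consecutive vertices of `L` are consecutive on
    -- `P`.
    InP : List (Fin n) → Set
    InP L = ∀ {m z z⁺} → At L m z → At L (suc m) z⁺ → ∃ λ l → At P l z × At P (suc l) z⁺

    Few Fewer : List (Fin n) → Set
    Few L   = count Both? L ≤ suc (count Neither? L)
    Fewer L = count Both? L ≤ count Neither? L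

    -- By `exclude-F`, the successor of a vertex seeing both sets sees no first vertex. By `stuck`
    -- it then sees neither set unless it ends the path, so the stronger bound holds for the tail.
    scan : ∀ L → InP L → Few L × (∀ {z} → At L 0 z → ¬ First.Has z → Fewer L)
    scan [] _ = z≤n , λ ()
    scan (z ∷ L) inP with scan L (λ t t′ → inP (there t) (there t′))
    ... | few , fewer with First.Has? z | Last.Has? z
    ...   | yes fz | yes gz = s≤s (bothCase L inP fewer) , λ { here ¬fz → ⊥-elim (¬fz fz) }
      where
      bothCase : ∀ L → InP (z ∷ L) → (∀ {z} → At L 0 z → ¬ First.Has z → Fewer L) → Fewer L
      bothCase []       _   _     = z≤n
      bothCase (z⁺ ∷ L) inP fewer = let l , tz , tz⁺ = inP here (there here) in
        fewer here (λ fz⁺ → Pair.exclude-F tz tz⁺ gz fz⁺ fz)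
    ...   | yes fz | no _   = few , λ { here ¬fz → ⊥-elim (¬fz fz) }
    ...   | no _   | no _   = m≤n⇒m≤1+n few , λ _ _ → few
    ...   | no ¬fz | yes gz = lastCase L inP , λ _ _ → lastCase′ L inP
      where
      lastCase′ : ∀ L → InP (z ∷ L) → Fewer L
      lastCase′ []       _   = z≤n
      lastCase′ (z⁺ ∷ L) inP = let l , tz , tz⁺ = inP here (there here) in ⊥-elim (¬fz (stuck tz tz⁺ gz))
      lastCase : ∀ L → InP (z ∷ L) → Few L
      lastCase L inP = m≤n⇒m≤1+n (lastCase′ L inP)

    few-both : count Both? P ≤ suc (count Neither? P)
    few-both = proj₁ (scan P (λ t t′ → _ , t , t′))

    V : List (Fin n)
    V = allFin n

    both-total : count Both? V ≤ count Both? P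
    both-total = count-⊆ Both? (Uniq.allFin⁺ n) (λ {z} _ both → decidable-stable (z ∈? P) (λ z∉ → outside-¬F z∉ (proj₁ both)))
      where open import Data.List.Membership.DecPropositional (Finₚ._≟_ {n}) using (_∈?_)

    neither-total : suc (count Neither? P) ≤ count Neither? V
    neither-total = begin
      suc (count Neither? P)           ≡⟨ cong (_+ count Neither? P) (ind-yes (Neither? h) (First.¬Has-h , Last.¬Has-h)) ⟨
      count Neither? (h ∷ P)           ≤⟨ count-⊆ Neither? (All.tabulate (λ r∈ eq → h∉P (subst (_∈ˡ P) (sym eq) r∈)) ∷ uP) (λ {z} _ _ → ∈-allFin z) ⟩
      count Neither? V                 ∎
      where open ≤-Reasoning

    -- On `P` the vertices of kind `Both` exceed those of kind `Neither` by at most one, and `h`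
    -- makes up for that one. So the two independent sets of nonseers together have at least n
    -- elements, while each has fewer than n/2.
    large-independent-set : (∀ (I : Subset n) → Independent G I → 2 * ∣ I ∣ < n) → ⊥
    large-independent-set α<n/2 = <⇒≱ (n<1+n (suc (count Neither? P))) (begin
      suc (suc (count Neither? P)) ≤⟨ s≤s neither-total ⟩
      suc (count Neither? V)       ≤⟨ +-cancelˡ-≤ n _ _ total ⟩
      count Both? V                ≤⟨ both-total ⟩
      count Both? P                ≤⟨ few-both ⟩
      suc (count Neither? P)       ∎)
      where
      open ≤-Reasoning
      NF NW : ℕ
      NF = count (¬? ∘ First.Has?) V
      NW = count (¬? ∘ Last.Has?) V
      independent : ∀ {H : Fin n → Set} (H? : Decidable H) → (∀ {p q} → ¬ H p → ¬ H q → ¬ Adj p q) → 2 * count (¬? ∘ H?) V < n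
      independent H? indep = subst (λ t → 2 * t < n) (∣subset∣ (¬? ∘ H?))
        (α<n/2 (subset (¬? ∘ H?)) (λ p q p∈ q∈ → indep (∈-subset⁻ (¬? ∘ H?) p∈) (∈-subset⁻ (¬? ∘ H?) q∈)))
      half : ∀ {a b} → 2 * a < n → 2 * b < n → a + b < n
      half {a} {b} a< b< = *-cancelˡ-< 2 (a + b) n (begin-strict
        2 * (a + b)   ≡⟨ *-distribˡ-+ 2 a b ⟩
        2 * a + 2 * b <⟨ +-mono-< a< b< ⟩
        n + n         ≡⟨ cong (n +_) (+-identityʳ n) ⟨
        2 * n         ∎)
      |V| : length V ≡ n
      |V| = length-tabulate {n = n} (λ i → i)
      total : n + suc (count Neither? V) ≤ n + count Both? V
      total = begin
        n + suc (count Neither? V)                     ≡⟨ +-suc n _ ⟩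
        suc (n + count Neither? V)                     ≡⟨ cong (λ t → suc (t + count Neither? V)) (trans (sym |V|) (sym (sumOver-const1 V))) ⟩
        suc (sumOver (λ _ → 1) V + count Neither? V)   ≡⟨ cong suc (sumOver-+ (λ _ → 1) (ind ∘ Neither?) V) ⟨
        suc (sumOver (λ z → 1 + ind (Neither? z)) V)   ≤⟨ s≤s (sumOver-mono V (λ {z} _ → ≤-reflexive (sym (four-kinds z)))) ⟩
        suc (sumOver (λ z → ind (¬? (First.Has? z)) + ind (¬? (Last.Has? z)) + ind (Both? z)) V) ≡⟨ cong suc (sumOver-3 (ind ∘ ¬? ∘ First.Has?) (ind ∘ ¬? ∘ Last.Has?) (ind ∘ Both?) V) ⟩
        suc (NF + NW + count Both? V)                  ≤⟨ +-monoˡ-≤ (count Both? V) (half {NF} {NW} (independent First.Has? First.empty-independent) (independent Last.Has? Last.empty-independent)) ⟩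
        n + count Both? V                              ∎

  -- Consequences of a vertex seeing only last vertices that has a successor

  sum-bound : ∀ {f g l : Arc P → ℕ} → (∀ {α} → α ∈ˡ αs → f α + g α + l α ≤ 1) →
    sumOver f αs + sumOver g αs + sumOver l αs ≤ length αs
  sum-bound {f} {g} {l} le = begin
    sumOver f αs + sumOver g αs + sumOver l αs ≡⟨ sumOver-3 f g l αs ⟨
    sumOver (λ α → f α + g α + l α) αs         ≤⟨ sumOver-mono αs le ⟩
    sumOver (λ _ → 1) αs                       ≡⟨ sumOver-const1 αs ⟩
    length αs                                  ∎
    where open ≤-Reasoning

  few-neither : ∀ {p q J} → Adj p q → ¬ First.Has p → ¬ Last.Has q → Unique J → (∀ {r} → r ∈ˡ J → Neither r) → length J < k
  few-neither f ¬fp ¬gq uJ neither = few-common-nonneighbours f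
    (uJ , λ r∈ s∈ → First.empty-independent (proj₁ (neither r∈)) (proj₁ (neither s∈)))
    (λ r∈ → First.empty-independent ¬fp (proj₁ (neither r∈)))
    (λ r∈ → Last.empty-independent ¬gq (proj₂ (neither r∈)))

  -- `a α` never sees a first vertex and `w α` never a last one. So `Mixed` says that some end sees
  -- the opposite set and `Plain` that some end sees neither; an arc can be both.
  Mixed Plain : Arc P → Set
  Mixed α = Last.Has (a α) ⊎ First.Has (w α)
  Plain α = ¬ Last.Has (a α) ⊎ ¬ First.Has (w α)

  Mixed? : Decidable Mixed
  Mixed? α = Last.Has? (a α) ⊎-dec First.Has? (w α)

  Plain? : Decidable Plain
  Plain? α = ¬? (Last.Has? (a α)) ⊎-dec ¬? (First.Has? (w α))

  Boundary : Set
  Boundary = ∃₂ λ α β → α ∈ˡ αs × β ∈ˡ αs × i β ≡ suc (e α) × First.Has (w α) × Last.Has (a β)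

  PlainStart : List (Arc P) → Set
  PlainStart []      = ⊤
  PlainStart (β ∷ _) = ¬ Last.Has (a β)

  boundary-or-plain : ∀ {B : Set} α {βs} → Chain P (suc (e α)) (y α) βs → First.Has (w α) →
    (∀ {β} → β ∈ˡ α ∷ βs → β ∈ˡ αs) → (PlainStart βs → B) → Boundary ⊎ B
  boundary-or-plain α (end _ _)  _  _   f = inj₂ (f tt)
  boundary-or-plain α (link β _) fw sub f with Last.Has? (a β)
  ... | yes gb = inj₁ (α , β , sub (here refl) , sub (there (here refl)) , refl , fw , gb)
  ... | no ¬gb = inj₂ (f ¬gb)

  -- Without a boundary between a mixed end and a mixed start, plain ends
  -- separate the mixed arcs.
  zigzag : ∀ {j p βs} → Chain P j p βs → (∀ {β} → β ∈ˡ βs → β ∈ˡ αs) →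
    Boundary ⊎ (count Mixed? βs ≤ suc (count Plain? βs) × (PlainStart βs → count Mixed? βs ≤ count Plain? βs))
  zigzag (end _ _) _ = inj₂ (z≤n , λ _ → z≤n)
  zigzag (link α {βs} c) sub with zigzag c (sub ∘ there)
  ... | inj₁ b = inj₁ b
  ... | inj₂ (weak , strong) with Last.Has? (a α) | First.Has? (w α)
  ...   | no _    | no _   = inj₂ (m≤n⇒m≤1+n weak , λ _ → weak)
  ...   | yes ga  | no _   = inj₂ (s≤s weak , λ ¬ga → ⊥-elim (¬ga ga))
  ...   | no _    | yes fw = boundary-or-plain α c fw sub (λ ps → s≤s (m≤n⇒m≤1+n (strong ps)) , λ _ → s≤s (strong ps))
  ...   | yes ga  | yes fw = boundary-or-plain α c fw sub (λ ps → s≤s (strong ps) , λ ¬ga → ⊥-elim (¬ga ga))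

  -- An end seeing neither set, if the arc is plain. On other arcs the value `w α` is a mere
  -- default.
  plainEnd : Arc P → Fin n
  plainEnd α with Last.Has? (a α)
  ... | yes _ = w α
  ... | no _  = a α

  plainEnd-at : ∀ α → ∃ λ j → At P j (plainEnd α) × i α < j × j ≤ e α
  plainEnd-at α with Last.Has? (a α)
  ... | yes _ = e α , at-w α , i<e α , ≤-refl
  ... | no _  = suc (i α) , at-a α , ≤-refl , i<e α

  plainEnd-neither : ∀ {α} → Plain α → Neither (plainEnd α)
  plainEnd-neither {α} plain with Last.Has? (a α) | plain
  ... | yes ga | inj₁ ¬ga = ⊥-elim (¬ga ga)
  ... | yes _  | inj₂ ¬fw = ¬fw , Last.¬Has-b α
  ... | no ¬ga | _        = First.¬Has-b α , ¬ga

  plainEnds : List (Fin n)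
  plainEnds = map plainEnd (filter Plain? αs)

  plainEnds-unique : Unique (h ∷ plainEnds)
  plainEnds-unique = All.tabulate h∉ ∷ AllPairsₚ.map⁺ (AllPairs.map distinct (AllPairsₚ.filter⁺ Plain? sorted))
    where
    h∉ : ∀ {r} → r ∈ˡ plainEnds → h ≢ r
    h∉ r∈ eq with ∈-map⁻ plainEnd r∈
    ... | α , _ , refl = h∉P (subst (_∈ˡ P) (sym eq) (At⇒∈ (proj₁ (proj₂ (plainEnd-at α)))))
    distinct : ∀ {α β} → e α < i β → plainEnd α ≢ plainEnd β
    distinct {α} {β} e<i eq =
      let j , tj , _ , j≤e = plainEnd-at α
          l , tl , i<l , _ = plainEnd-at β
      in <⇒≢ (<-trans (≤-<-trans j≤e e<i) i<l) (At-inj uP tj (subst (At P l) (sym eq) tl))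

  -- `h` and one end of each plain arc see neither set. Nonseers of a common set are independent, so
  -- these vertices are pairwise nonadjacent and missed by both `p` and `q`.
  plain-bound : ∀ {p q} → Adj p q → ¬ First.Has p → ¬ Last.Has q → suc (count Plain? αs) < k
  plain-bound f ¬fp ¬gq = subst (λ t → suc t < k) (trans (length-map plainEnd (filter Plain? αs)) (sym (count-filter Plain? αs)))
    (few-neither f ¬fp ¬gq plainEnds-unique neither)
    where
    neither : ∀ {r} → r ∈ˡ h ∷ plainEnds → Neither r
    neither (here refl) = First.¬Has-h , Last.¬Has-h
    neither (there r∈) with ∈-map⁻ plainEnd r∈
    ... | α , α∈ , refl = plainEnd-neither (proj₂ (∈-filter⁻ Plain? {xs = αs} α∈))

  module Switch {m z z⁺} (tz : At P m z) (tz⁺ : At P (suc m) z⁺) (gz : Last.Has z) (¬fz : ¬ First.Has z) where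
    open Pair tz tz⁺

    fz⁺ : First.Has z⁺
    fz⁺ = cover-F ¬fz

    ¬gz⁺ : ¬ Last.Has z⁺
    ¬gz⁺ = exclude-W gz fz⁺

    -- A `w α` adjacent to `z` must see a first vertex, because `z` sees none; dually for an `a α`
    -- adjacent to `z⁺`. Only the own arc can serve both, which costs one of the 2φ + 2 incidences.
    many-mixed : suc (φ + φ) ≤ count Mixed? αs
    many-mixed = ≤-pred (begin
      suc (suc (φ + φ))                 ≡⟨ cong suc (+-suc φ φ) ⟨
      suc φ + suc φ                     ≤⟨ +-mono-≤ (Last.many-¬h (z≁h fz⁺) gz) (First.many-¬h (z⁺≁h gz) fz⁺) ⟩
      Last.c z + First.c z⁺                    ≡⟨ sumOver-+ _ _ αs ⟨
      sumOver (λ α → ind (adj? z (w α)) + ind (adj? z⁺ (a α))) αs ≤⟨ sumOver-mono αs (λ {α} _ → le α) ⟩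
      sumOver (λ α → ind (Mixed? α) + ind (Own? α)) αs            ≡⟨ sumOver-+ (ind ∘ Mixed?) (ind ∘ Own?) αs ⟩
      count Mixed? αs + count Own? αs   ≤⟨ +-monoʳ-≤ (count Mixed? αs) own≤1 ⟩
      count Mixed? αs + 1               ≡⟨ +-comm (count Mixed? αs) 1 ⟩
      suc (count Mixed? αs)             ∎)
      where
      open ≤-Reasoning
      mixed-w : ∀ α → Adj z (w α) → Mixed α
      mixed-w α g = inj₂ (decidable-stable (First.Has? (w α)) (λ ¬fw → First.empty-independent ¬fz ¬fw g))
      mixed-a : ∀ α → Adj z⁺ (a α) → Mixed α
      mixed-a α f = inj₁ (decidable-stable (Last.Has? (a α)) (λ ¬ga → Last.empty-independent ¬gz⁺ ¬ga f))
      le : ∀ α → ind (adj? z (w α)) + ind (adj? z⁺ (a α)) ≤ ind (Mixed? α) + ind (Own? α)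
      le α with adj? z (w α) | adj? z⁺ (a α)
      ... | no _  | no _  = z≤n
      ... | no _  | yes f = ≤-trans (≤-reflexive (sym (ind-yes (Mixed? α) (mixed-a α f)))) (m≤m+n _ _)
      ... | yes g | no _  = ≤-trans (≤-reflexive (sym (ind-yes (Mixed? α) (mixed-w α g)))) (m≤m+n _ _)
      ... | yes g | yes f = ≤-reflexive (sym (cong₂ _+_ (ind-yes (Mixed? α) (mixed-a α f)) (ind-yes (Own? α) own)))
        where
        own : Own α
        own = decidable-stable (Own? α) (λ ¬own → <-asym (succ-after-pred α α f g) (inside′ α ¬own (a≢z⁺ fz⁺ α) (w≢z gz α)))

    boundary : Boundary
    boundary with zigzag ch (λ β∈ → β∈)
    ... | inj₁ b = b
    -- Without a boundary at most one more arc is mixed than plain, so at most k - 1 ≤ 2φ arcs are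
    -- mixed.
    ... | inj₂ (few , _) = ⊥-elim (<⇒≱ (plain-bound z~z⁺ ¬fz ¬gz⁺)
            (≤-trans k≤1+2φ (≤-trans many-mixed few)))

  module AtBoundary {α β} (α∈ : α ∈ˡ αs) (β∈ : β ∈ˡ αs) (i≡ : i β ≡ suc (e α)) (fw : First.Has (w α)) (ga : Last.Has (a β)) where

    private
      ta : At P (suc (suc (e α))) (a β)
      ta = subst (λ j → At P (suc j) (a β)) i≡ (at-a β)

    module C₁ = Pair (at-w α) (at-y α)
    module C₂ = Pair (at-y α) ta

    w≁a : ¬ Adj (a β) (w α)
    w≁a = C₂.not-both-w α α∈ (adj-sym C₁.z~z⁺)

    -- `w α` is set aside because it is the first vertex of the cut `C₁`, where `succ-after-pred′`
    -- does not apply.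
    Other : Arc P → Set
    Other γ = Adj (y α) (w γ) × w γ ≢ w α

    Other? : Decidable Other
    Other? γ = adj? (y α) (w γ) ×-dec ¬? (w γ Finₚ.≟ w α)

    order₁ : ∀ γ → γ ∈ˡ αs → w γ ≢ w α → C₁.κ (i γ) < C₁.κ (e γ)
    order₁ γ γ∈ w≢ = C₁.inside′ γ not-own (λ eq → h≁a γ (subst (Adj h) (sym eq) (Xy α))) w≢
      where
      not-own : ¬ C₁.Own γ
      not-own (i<m , m<e) with AllPairs-total sorted γ∈ α∈
      ... | inj₁ refl        = <-irrefl refl m<e
      ... | inj₂ (inj₁ γ<α) = <-asym m<e (<-trans γ<α (i<e α))
      ... | inj₂ (inj₂ α<γ) = <-asym i<m α<γ

    a≢y : ∀ γ → a γ ≢ y α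
    a≢y γ eq = h≁a γ (subst (Adj h) (sym eq) (Xy α))

    w≢y : ∀ γ → w γ ≢ y α
    w≢y γ eq = h≁w γ (subst (Adj h) (sym eq) (Xy α))

    -- If `y α` sees no last vertex but `w α`, the bound is immediate. Otherwise the first vertices
    -- seen by `w α`, the other last vertices seen by `y α` and the last vertices seen by `a β` lie
    -- in distinct arcs: at least (φ + 1) + (φ - 1) + (φ + 1) = 3φ + 1 of them, where only 3φ can
    -- exist.
    φ≤1 : φ ≤ 1
    φ≤1 with Any.any? Other? αs
    ... | no none = ≤-trans (Last.many-h (Xy α)) (≤-trans (sumOver-mono αs le)
                     (count-atMostOne (λ γ → e γ ≟ e α) (AllPairs.map (λ d p q → d (trans p (sym q))) distinct-e)))
      where
      le : ∀ {γ} → γ ∈ˡ αs → ind (adj? (y α) (w γ)) ≤ ind (e γ ≟ e α)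
      le {γ} γ∈ with adj? (y α) (w γ)
      ... | no _  = z≤n
      ... | yes f = ≤-reflexive (sym (ind-yes (e γ ≟ e α) (decidable-stable (e γ ≟ e α)
                      (λ e≢ → none (lose γ∈ (f , λ eq → e≢ (At-inj uP (at-w γ) (subst (At P (e α)) (sym eq) (at-w α)))))))))
    ... | yes some with find some
    ...   | δ , δ∈ , y~wδ , wδ≢ = ⊥-elim (<⇒≱ (n<1+n (φ + (φ + φ))) (begin
      suc (φ + (φ + φ))                          ≡⟨ cong suc (+-assoc φ φ φ) ⟨
      suc φ + φ + φ                              ≤⟨ ≤-pred bound ⟩
      length αs                                  ≤⟨ ≤-pred (≤-trans (≤-reflexive |αs|) (≤-trans (+-monoʳ-≤ φ k≤1+2φ) (≤-reflexive (+-suc φ (φ + φ))))) ⟩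
      φ + (φ + φ)                                ∎))
      where
      open ≤-Reasoning
      -- The cuts before and after `y α` are one step apart, so an order found at `C₂` can be
      -- chained with one found at `C₁`.
      κ-shift : ∀ γ → w γ ≢ w α → C₁.κ (e γ) ≡ suc (C₂.κ (e γ))
      κ-shift γ w≢ = rotated-shift (length P) (e α) 1+e<|P| (w≢z⇒ (at-w α) (at-y α) γ w≢) (w≢z⇒ (at-y α) ta γ (w≢y γ))
        where
        1+e<|P| : suc (e α) < length P
        1+e<|P| = At-< (at-y α)
      exclusive : ∀ {γ} → γ ∈ˡ αs → ind (adj? (w α) (a γ)) + ind (Other? γ) + ind (adj? (a β) (w γ)) ≤ 1
      exclusive {γ} γ∈ = three-exclusive (adj? (w α) (a γ)) (Other? γ) (adj? (a β) (w γ)) (no (λ (x : ⊥) → x))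
        (λ (f , _) g → C₂.not-both-w γ γ∈ f g)
        (λ _ f (g , w≢) → <-asym (C₁.succ-after-pred′ γ γ (a≢y γ) w≢ f g) (order₁ γ γ∈ w≢))
        (λ _ f g → let w≢ : w γ ≢ w α
                       w≢ eq = w≁a (subst (Adj (a β)) eq g)
                       lt = C₂.pred-order δ γ γ∈ (w≢y γ) y~wδ g
                       lt′ = subst₂ _<_ (sym (κ-shift γ w≢)) (sym (κ-shift δ wδ≢)) (s≤s lt)
                   in <-asym (<-trans lt′ (C₁.succ-after-pred′ γ δ (a≢y γ) wδ≢ f y~wδ)) (order₁ γ γ∈ w≢))
      others : φ ≤ suc (count Other? αs)
      others = begin
        φ                                                          ≤⟨ Last.many-h (Xy α) ⟩
        Last.c (y α)                                                  ≤⟨ sumOver-mono αs (λ {γ} _ → le γ) ⟩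
        sumOver (λ γ → ind (e γ ≟ e α) + ind (Other? γ)) αs        ≡⟨ sumOver-+ (λ γ → ind (e γ ≟ e α)) (ind ∘ Other?) αs ⟩
        count (λ γ → e γ ≟ e α) αs + count Other? αs               ≤⟨ +-monoˡ-≤ (count Other? αs) (count-atMostOne (λ γ → e γ ≟ e α) (AllPairs.map (λ d p q → d (trans p (sym q))) distinct-e)) ⟩
        suc (count Other? αs)                                      ∎
        where
        le : ∀ γ → ind (adj? (y α) (w γ)) ≤ ind (e γ ≟ e α) + ind (Other? γ)
        le γ with adj? (y α) (w γ) | e γ ≟ e α
        ... | no _  | _      = z≤n
        ... | yes _ | yes _  = s≤s z≤n
        ... | yes f | no e≢ with w γ Finₚ.≟ w α
        ...   | yes eq = ⊥-elim (e≢ (At-inj uP (at-w γ) (subst (At P (e α)) (sym eq) (at-w α))))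
        ...   | no _   = ≤-refl
      bound : suc (suc φ + φ + φ) ≤ suc (length αs)
      bound = begin
        suc (suc φ + φ + φ)                                ≡⟨ +-suc (suc φ + φ) φ ⟨
        suc φ + φ + suc φ                                  ≤⟨ +-mono-≤ (+-mono-≤ (First.many-¬h (h≁w α) fw) others) (Last.many-¬h (h≁a β) ga) ⟩
        First.c (w α) + suc (count Other? αs) + Last.c (a β)      ≡⟨ cong (_+ Last.c (a β)) (+-suc (First.c (w α)) (count Other? αs)) ⟩
        suc (First.c (w α) + count Other? αs + Last.c (a β))      ≤⟨ s≤s (sum-bound exclusive) ⟩
        suc (length αs)                                    ∎

    -- Otherwise `h`, `a β` and `r` are independent, since none sees a first vertex, and both ends
    -- of an edge from `w α` to a first vertex `a γ` miss all three.
    only-h : k ≡ 3 → ∀ r → Neither r → r ≡ h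
    only-h k≡3 r (¬fr , ¬gr) = decidable-stable (r Finₚ.≟ h) λ r≢h →
      let γ , _ , f = find fw in
      <-irrefl (sym k≡3) (few-common-nonneighbours f (unique r≢h , λ p∈ q∈ → First.empty-independent (¬F p∈) (¬F q∈))
        (λ { (here refl) → λ wh → h≁w α (adj-sym wh)
           ; (there (here refl)) → w≁a ∘ adj-sym
           ; (there (there (here refl))) → Last.empty-independent (Last.¬Has-b α) ¬gr })
        (λ q∈ → First.empty-independent (First.¬Has-b γ) (¬F q∈)))
      where
      J : List (Fin n)
      J = h ∷ a β ∷ r ∷ []
      ¬F : ∀ {p} → p ∈ˡ J → ¬ First.Has p
      ¬F (here refl)                 = First.¬Has-h
      ¬F (there (here refl))         = First.¬Has-b β
      ¬F (there (there (here refl))) = ¬fr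
      unique : r ≢ h → Unique J
      unique r≢h = ((λ eq → h∉P (subst (_∈ˡ P) (sym eq) (At⇒∈ (at-a β)))) ∷ (r≢h ∘ sym) ∷ [])
        ∷ ((λ eq → ¬gr (subst Last.Has eq ga)) ∷ []) ∷ [] ∷ []

  -- With φ = 1 there are exactly `k` arcs and k ≤ 3, while 2φ + 1 = 3 arcs are mixed.
  exceptional : ∀ {m z z⁺} → At P m z → At P (suc m) z⁺ → Last.Has z → ¬ First.Has z →
    φ ≡ 1 × k ≡ 3 × length αs ≡ 3 × (∀ r → Neither r → r ≡ h)
  exceptional tz tz⁺ gz ¬fz with Switch.boundary tz tz⁺ gz ¬fz
  ... | α , β , α∈ , β∈ , i≡ , fw , ga = φ≡1 , k≡3 , trans |αs|≡k k≡3 , AtBoundary.only-h α∈ β∈ i≡ fw ga k≡3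
    where
    φ≡1 : φ ≡ 1
    φ≡1 = ≤-antisym (AtBoundary.φ≤1 α∈ β∈ i≡ fw ga) 1≤φ
    |αs|≡k : length αs ≡ k
    |αs|≡k = suc-injective (trans |αs| (cong (_+ k) φ≡1))
    count≤ : count Mixed? αs ≤ length αs
    count≤ = ≤-trans (sumOver-mono αs (λ {γ} _ → ind≤1 (Mixed? γ))) (≤-reflexive (sumOver-const1 αs))
    k≡3 : k ≡ 3
    k≡3 = ≤-antisym (≤-trans k≤1+2φ (≤-reflexive (cong (λ t → suc (t + t)) φ≡1)))
      (≤-trans (≤-reflexive (cong (λ t → suc (t + t)) (sym φ≡1)))
        (≤-trans (Switch.many-mixed tz tz⁺ gz ¬fz) (≤-trans count≤ (≤-reflexive |αs|≡k))))

  -- The exceptional configuration on eleven vertices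

  ThreeArcs : List (Arc P) → Set
  ThreeArcs βs = ∃ λ α₁ → ∃₂ λ α₂ α₃ → βs ≡ α₁ ∷ α₂ ∷ α₃ ∷ [] × i α₂ ≡ suc (e α₁) × i α₃ ≡ suc (e α₂)

  three-arcs : ∀ {j p βs} → Chain P j p βs → length βs ≡ 3 → ThreeArcs βs
  three-arcs (link α₁ (link α₂ (link α₃ (end _ _)))) _ = α₁ , α₂ , α₃ , refl , refl , refl
  three-arcs (end _ _) ()
  three-arcs (link _ (end _ _)) ()
  three-arcs (link _ (link _ (end _ _))) ()
  three-arcs (link _ (link _ (link _ (link _ _)))) ()

  module Exceptional (φ≡1 : φ ≡ 1) (k≡3 : k ≡ 3) (only-h : ∀ r → Neither r → r ≡ h)
    (α₁ α₂ α₃ : Arc P) (αs≡ : αs ≡ α₁ ∷ α₂ ∷ α₃ ∷ []) (i₂≡ : i α₂ ≡ suc (e α₁)) (i₃≡ : i α₃ ≡ suc (e α₂)) where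

    open import Data.List.Membership.DecPropositional (Finₚ._≟_ {n}) using (_∈?_)
    open import Data.List.Relation.Unary.Unique.DecPropositional (Finₚ._≟_ {11}) using (unique?)

    10F : Fin 11
    10F = suc 9F

    x₁ x₂ x₃ x₄ a₁ a₂ a₃ w₁ w₂ w₃ : Fin n
    x₁ = x α₁
    x₂ = x α₂
    x₃ = x α₃
    x₄ = y α₃
    a₁ = a α₁
    a₂ = a α₂
    a₃ = a α₃
    w₁ = w α₁
    w₂ = w α₂
    w₃ = w α₃

    α₁∈ : α₁ ∈ˡ αs
    α₁∈ = subst (α₁ ∈ˡ_) (sym αs≡) (here refl)
    α₃∈ : α₃ ∈ˡ αs
    α₃∈ = subst (α₃ ∈ˡ_) (sym αs≡) (there (there (here refl)))

    for-arcs : ∀ {Q : Arc P → Set} → Q α₁ → Q α₂ → Q α₃ → ∀ {γ} → γ ∈ˡ αs → Q γ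
    for-arcs q₁ q₂ q₃ γ∈ with subst (_ ∈ˡ_) αs≡ γ∈
    ... | here refl                 = q₁
    ... | there (here refl)         = q₂
    ... | there (there (here refl)) = q₃

    y₁≡x₂ : y α₁ ≡ x₂
    y₁≡x₂ = At-det (at-y α₁) (subst (λ j → At P j x₂) i₂≡ (at-x α₂))
    y₂≡x₃ : y α₂ ≡ x₃
    y₂≡x₃ = At-det (at-y α₂) (subst (λ j → At P j x₃) i₃≡ (at-x α₃))

    e₁<i₂ : e α₁ < i α₂
    e₁<i₂ = ≤-reflexive (sym i₂≡)
    e₂<i₃ : e α₂ < i α₃
    e₂<i₃ = ≤-reflexive (sym i₃≡)

    ∈P⇒≢h : ∀ {j p} → At P j p → p ≢ h
    ∈P⇒≢h t eq = h∉P (subst (_∈ˡ P) eq (At⇒∈ t))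

    ¬F⇒W : ∀ {j p} → At P j p → ¬ First.Has p → Last.Has p
    ¬F⇒W {p = p} t ¬fp = decidable-stable (Last.Has? p) (λ ¬gp → ∈P⇒≢h t (only-h p (¬fp , ¬gp)))

    ¬W⇒F : ∀ {j p} → At P j p → ¬ Last.Has p → First.Has p
    ¬W⇒F {p = p} t ¬gp = decidable-stable (First.Has? p) (λ ¬fp → ∈P⇒≢h t (only-h p (¬fp , ¬gp)))

    two-F : ∀ {p} → ¬ Adj h p → First.Has p → Adj p a₁ × Adj p a₂ ⊎ Adj p a₁ × Adj p a₃ ⊎ Adj p a₂ × Adj p a₃
    two-F {p} ¬hp fp = two-of-three (adj? p a₁) (adj? p a₂) (adj? p a₃)
      (≤-trans (≤-reflexive (cong suc (sym φ≡1))) (subst (λ βs → suc φ ≤ count (λ α → adj? p (a α)) βs) αs≡ (First.many-¬h ¬hp fp)))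

    two-W : ∀ {p} → ¬ Adj h p → Last.Has p → Adj p w₁ × Adj p w₂ ⊎ Adj p w₁ × Adj p w₃ ⊎ Adj p w₂ × Adj p w₃
    two-W {p} ¬hp gp = two-of-three (adj? p w₁) (adj? p w₂) (adj? p w₃)
      (≤-trans (≤-reflexive (cong suc (sym φ≡1))) (subst (λ βs → suc φ ≤ count (λ α → adj? p (w α)) βs) αs≡ (Last.many-¬h ¬hp gp)))

    a-has : ∀ α → Last.Has (a α)
    a-has α = ¬F⇒W (at-a α) (First.¬Has-b α)

    -- `a α` sees a last vertex and `w α` does not, so they differ.
    1+i<e : ∀ α → suc (i α) < e α
    1+i<e α = ≤∧≢⇒< (i<e α) (λ eq → Last.¬Has-b α (subst Last.Has (At-det (subst (λ j → At P j (a α)) eq (at-a α)) (at-w α)) (a-has α)))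

    -- The vertex after `a α` sees at least two of the three first vertices, because `a α` sees none
    -- and a last one. The order at this edge restricts which two.
    module Far (α : Arc P) where
      next : ∃ λ z⁺ → At P (suc (suc (i α))) z⁺
      next = At-≤ (at-y α) (s≤s (i<e α))
      open Pair (at-a α) (proj₂ next)

      m : ℕ
      m = suc (i α)

      fz⁺ : First.Has (proj₁ next)
      fz⁺ = cover-F (First.¬Has-b α)

      two : Adj (proj₁ next) a₁ × Adj (proj₁ next) a₂ ⊎ Adj (proj₁ next) a₁ × Adj (proj₁ next) a₃ ⊎ Adj (proj₁ next) a₂ × Adj (proj₁ next) a₃
      two = two-F (z⁺≁h (a-has α)) fz⁺

      late : ∀ (γ δ : Arc P) → rotated (length P) m (i γ) < rotated (length P) m (e δ) → Adj (a α) (w δ) → ¬ Adj (proj₁ next) (a γ)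
      late γ δ lt g f = <-asym lt (succ-after-pred γ δ f g)

    -- Otherwise the vertex after `a₁` could see neither `a₂` nor `a₃`, leaving it one first vertex
    -- instead of two. The next two lemmas are the cyclic shifts of this one.
    a₁≁w₃ : ¬ Adj a₁ w₃
    a₁≁w₃ g = absurd two
      where
      open Far α₁
      m<i₂ : suc (i α₁) < i α₂
      m<i₂ = <-trans (1+i<e α₁) e₁<i₂
      i₂<i₃ : i α₂ < i α₃
      i₂<i₃ = <-trans (i<e α₂) e₂<i₃
      no₂ = late α₂ α₃ (rotated-< (length P) m (<-trans i₂<i₃ (i<e α₃)) (inj₂ m<i₂)) g
      no₃ = late α₃ α₃ (rotated-< (length P) m (i<e α₃) (inj₂ (<-trans m<i₂ i₂<i₃))) g
      absurd : _ → ⊥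
      absurd (inj₁ (_ , f))        = no₂ f
      absurd (inj₂ (inj₁ (_ , f))) = no₃ f
      absurd (inj₂ (inj₂ (f , _))) = no₂ f

    a₂≁w₁ : ¬ Adj a₂ w₁
    a₂≁w₁ g = absurd two
      where
      open Far α₂
      e₁≤m : e α₁ ≤ suc (i α₂)
      e₁≤m = <⇒≤ (m<n⇒m<1+n e₁<i₂)
      no₃ = late α₃ α₁ (rotated-wrap (length P) m (At-< (at-x α₃)) (<-trans (1+i<e α₂) e₂<i₃) e₁≤m) g
      no₁ = late α₁ α₁ (rotated-< (length P) m (i<e α₁) (inj₁ e₁≤m)) g
      absurd : _ → ⊥
      absurd (inj₁ (f , _))        = no₁ f
      absurd (inj₂ (inj₁ (f , _))) = no₁ f
      absurd (inj₂ (inj₂ (_ , f))) = no₃ f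

    a₃≁w₂ : ¬ Adj a₃ w₂
    a₃≁w₂ g = absurd two
      where
      open Far α₃
      e₂≤m : e α₂ ≤ suc (i α₃)
      e₂≤m = <⇒≤ (m<n⇒m<1+n e₂<i₃)
      no₁ = late α₁ α₂ (rotated-< (length P) m (<-trans (i<e α₁) (<-trans e₁<i₂ (i<e α₂))) (inj₁ e₂≤m)) g
      no₂ = late α₂ α₂ (rotated-< (length P) m (i<e α₂) (inj₁ e₂≤m)) g
      absurd : _ → ⊥
      absurd (inj₁ (f , _))        = no₁ f
      absurd (inj₂ (inj₁ (f , _))) = no₁ f
      absurd (inj₂ (inj₂ (f , _))) = no₂ f

    -- Two of three neighbours remain for each `aᵢ`, which gives the six-cycle `a₁ w₁ a₃ w₃ a₂ w₂`.
    -- Identifying `x₁` with `x₄` makes its opposite pairs the neighbours of the three vertices next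
    -- to `h`, as in the Petersen graph.
    a₁~w₁w₂ : Adj a₁ w₁ × Adj a₁ w₂
    a₁~w₁w₂ = without-third a₁≁w₃ (two-W (h≁a α₁) (a-has α₁))

    a₂~w₂w₃ : Adj a₂ w₂ × Adj a₂ w₃
    a₂~w₂w₃ = without-first a₂≁w₁ (two-W (h≁a α₂) (a-has α₂))

    a₃~w₁w₃ : Adj a₃ w₁ × Adj a₃ w₃
    a₃~w₁w₃ = without-second a₃≁w₂ (two-W (h≁a α₃) (a-has α₃))

    -- If `p` missed `s`, then `h`, `r`, `s` would be three independent vertices missed by both ends
    -- of p q, against k = 3.
    misses-one : ∀ {p q} → Adj p q → ¬ Adj p h → ¬ Adj q h →
      ∀ {r s} → ¬ Adj p r → ¬ Adj q r → ¬ Adj q s → ¬ Adj h r → ¬ Adj h s → ¬ Adj r s → h ≢ r → h ≢ s → r ≢ s → Adj p s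
    misses-one {p} {q} f ph qh {r} {s} pr qr qs hr hs rs h≢r h≢s r≢s = decidable-stable (adj? p s) λ ps →
      <-irrefl (sym k≡3) (few-common-nonneighbours f
        (((h≢r ∷ h≢s ∷ []) ∷ (r≢s ∷ []) ∷ [] ∷ []) , indep)
        (λ { (here refl) → ph ; (there (here refl)) → pr ; (there (there (here refl))) → ps })
        (λ { (here refl) → qh ; (there (here refl)) → qr ; (there (there (here refl))) → qs }))
      where
      indep : ∀ {t t′} → t ∈ˡ h ∷ r ∷ s ∷ [] → t′ ∈ˡ h ∷ r ∷ s ∷ [] → ¬ Adj t t′
      indep (here refl)                 (here refl)                 = irr
      indep (here refl)                 (there (here refl))         = hr
      indep (here refl)                 (there (there (here refl))) = hs
      indep (there (here refl))         (here refl)                 = hr ∘ adj-sym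
      indep (there (here refl))         (there (here refl))         = irr
      indep (there (here refl))         (there (there (here refl))) = rs
      indep (there (there (here refl))) (here refl)                 = hs ∘ adj-sym
      indep (there (there (here refl))) (there (here refl))         = rs ∘ adj-sym
      indep (there (there (here refl))) (there (there (here refl))) = irr

    -- `h`, `a δ` and `p` see no first vertex, hence are independent. Choosing `δ` with `w γ`
    -- nonadjacent to `a δ`, the edge from `w γ` to `a γ` forces `w γ` to see `p`.
    ¬F-complete : ∀ {j p} → At P j p → ¬ First.Has p → p ∉ˡ a₁ ∷ a₂ ∷ a₃ ∷ [] → ∀ {γ} → γ ∈ˡ αs → Adj p (w γ)
    ¬F-complete {p = p} t ¬fp p∉ = for-arcs
      (adj-sym (go α₁ α₂ (adj-sym (proj₁ a₁~w₁w₂)) (a₂≁w₁ ∘ adj-sym) (λ eq → p∉ (there (here (sym eq))))))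
      (adj-sym (go α₂ α₃ (adj-sym (proj₁ a₂~w₂w₃)) (a₃≁w₂ ∘ adj-sym) (λ eq → p∉ (there (there (here (sym eq)))))))
      (adj-sym (go α₃ α₁ (adj-sym (proj₂ a₃~w₁w₃)) (a₁≁w₃ ∘ adj-sym) (λ eq → p∉ (here (sym eq)))))
      where
      E = First.empty-independent
      go : ∀ γ δ → Adj (w γ) (a γ) → ¬ Adj (w γ) (a δ) → a δ ≢ p → Adj (w γ) p
      go γ δ f ¬f a≢ = misses-one f (h≁w γ ∘ adj-sym) (h≁a γ ∘ adj-sym) ¬f (a≁a γ δ) (E (First.¬Has-b γ) ¬fp)
        (h≁a δ) (E First.¬Has-h ¬fp) (E (First.¬Has-b δ) ¬fp) (∈P⇒≢h (at-a δ) ∘ sym) (∈P⇒≢h t ∘ sym) a≢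

    ¬W-complete : ∀ {j p} → At P j p → ¬ Last.Has p → p ∉ˡ w₁ ∷ w₂ ∷ w₃ ∷ [] → ∀ {γ} → γ ∈ˡ αs → Adj p (a γ)
    ¬W-complete {p = p} t ¬gp p∉ = for-arcs
      (adj-sym (go α₁ α₃ (proj₁ a₁~w₁w₂) a₁≁w₃ (λ eq → p∉ (there (there (here (sym eq)))))))
      (adj-sym (go α₂ α₁ (proj₁ a₂~w₂w₃) a₂≁w₁ (λ eq → p∉ (here (sym eq)))))
      (adj-sym (go α₃ α₂ (proj₂ a₃~w₁w₃) a₃≁w₂ (λ eq → p∉ (there (here (sym eq))))))
      where
      E = Last.empty-independent
      go : ∀ γ δ → Adj (a γ) (w γ) → ¬ Adj (a γ) (w δ) → w δ ≢ p → Adj (a γ) p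
      go γ δ f ¬f w≢ = misses-one f (h≁a γ ∘ adj-sym) (h≁w γ ∘ adj-sym) ¬f (w≁w γ δ) (E (Last.¬Has-b γ) ¬gp)
        (h≁w δ) (E Last.¬Has-h ¬gp) (E (Last.¬Has-b δ) ¬gp) (∈P⇒≢h (at-w δ) ∘ sym) (∈P⇒≢h t ∘ sym) w≢

    module _ {m z z⁺} (tz : At P m z) (tz⁺ : At P (suc m) z⁺) where
      open Pair tz tz⁺

      private
        own : ∀ {γ} → Last.Has z → First.Has z⁺ → Adj z (w γ) → Adj z⁺ (a γ) → Own γ
        own {γ} gz fz⁺ g f = decidable-stable (Own? γ)
          (λ ¬own → <-asym (succ-after-pred γ γ f g) (inside′ γ ¬own (a≢z⁺ fz⁺ γ) (w≢z gz γ)))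

      -- `z⁺` would see two first vertices `a γ`. As `z` sees each `w γ`, both arcs would have to
      -- contain the edge z z⁺.
      ¬F-last : ¬ First.Has z → (∀ {γ} → γ ∈ˡ αs → Adj z (w γ)) → ⊥
      ¬F-last ¬fz all = <⇒≱ (≤-trans (s≤s 1≤φ) (First.many-¬h (z⁺≁h gz) fz⁺)) (≤-trans (sumOver-mono αs le) own≤1)
        where
        gz : Last.Has z
        gz = lose α₁∈ (all α₁∈)
        fz⁺ : First.Has z⁺
        fz⁺ = cover-F ¬fz
        le : ∀ {γ} → γ ∈ˡ αs → ind (adj? z⁺ (a γ)) ≤ ind (Own? γ)
        le {γ} γ∈ with adj? z⁺ (a γ)
        ... | no _  = z≤n
        ... | yes f = ≤-reflexive (sym (ind-yes (Own? γ) (own {γ} gz fz⁺ (all γ∈) f)))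

      ¬W-first : ¬ Last.Has z⁺ → (∀ {γ} → γ ∈ˡ αs → Adj z⁺ (a γ)) → ⊥
      ¬W-first ¬gz⁺ all = <⇒≱ (≤-trans (s≤s 1≤φ) (Last.many-¬h (z≁h fz⁺) gz)) (≤-trans (sumOver-mono αs le) own≤1)
        where
        gz : Last.Has z
        gz = cover-W⁻ ¬gz⁺
        fz⁺ : First.Has z⁺
        fz⁺ = lose α₁∈ (all α₁∈)
        le : ∀ {γ} → γ ∈ˡ αs → ind (adj? z (w γ)) ≤ ind (Own? γ)
        le {γ} γ∈ with adj? z (w γ)
        ... | no _  = z≤n
        ... | yes g = ≤-reflexive (sym (ind-yes (Own? γ) (own {γ} gz fz⁺ g (all γ∈))))

      before-both : Both z⁺ → First.Has z × ¬ Last.Has z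
      before-both (fz⁺ , gz⁺) = ¬W⇒F tz ¬gz , ¬gz
        where
        ¬gz : ¬ Last.Has z
        ¬gz gz = exclude-W gz fz⁺ gz⁺

    both-h : ∀ {p} → Adj h p → Both p
    both-h hp = First.has-h hp , Last.has-h hp

    -- A predecessor of `x₁` would see no last vertex and differ from all `wᵢ`, so it would see
    -- `a₁`, which `x₁` sees as well; `not-both-a` forbids this.
    i₁≡0 : i α₁ ≡ 0
    i₁≡0 with i α₁ in eq
    ... | zero  = refl
    ... | suc m = ⊥-elim (Pair.not-both-a tp tx α₁ α₁∈ (¬W-complete tp ¬gp p∉ α₁∈) (At-Cut.z~z⁺ (at-x α₁) (at-a α₁)))
      where
      tx : At P (suc m) x₁
      tx = subst (λ j → At P j x₁) eq (at-x α₁)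
      p = proj₁ (At-≤ tx (n≤1+n m))
      tp : At P m p
      tp = proj₂ (At-≤ tx (n≤1+n m))
      ¬gp : ¬ Last.Has p
      ¬gp = proj₂ (before-both tp tx (both-h (Xx α₁)))
      m<i₁ : m < i α₁
      m<i₁ = ≤-reflexive (sym eq)
      m<e₂ : m < e α₂
      m<e₂ = <-trans m<i₁ (<-trans (i<e α₁) (<-trans e₁<i₂ (i<e α₂)))
      not : ∀ γ → m < e γ → p ≢ w γ
      not γ m<e p≡ = <⇒≢ m<e (At-inj uP tp (subst (At P (e γ)) (sym p≡) (at-w γ)))
      p∉ : p ∉ˡ w₁ ∷ w₂ ∷ w₃ ∷ []
      p∉ (here p≡)                 = not α₁ (<-trans m<i₁ (i<e α₁)) p≡
      p∉ (there (here p≡))         = not α₂ m<e₂ p≡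
      p∉ (there (there (here p≡))) = not α₃ (<-trans m<e₂ (<-trans e₂<i₃ (i<e α₃))) p≡

    u≡x₁ : u ≡ x₁
    u≡x₁ = At-det (Segments.first Adj sP) (subst (λ j → At P j x₁) i₁≡0 (at-x α₁))

    last-index : ∃ λ l → At P l v × suc l ≡ length P
    last-index = Segments.final Adj sP

    x₄-last : ∀ {q} → At P (suc (suc (e α₃))) q → ⊥
    x₄-last {q} tq = Pair.not-both-w (at-y α₃) tq α₃ α₃∈ (adj-sym (At-Cut.z~z⁺ (at-w α₃) (at-y α₃))) (¬F-complete tq ¬fq q∉ α₃∈)
      where
      ¬fq : ¬ First.Has q
      ¬fq fq = let γ , _ , f = find fq in after-h (at-y α₃) tq (Xy α₃) γ f
      i₃< : i α₃ < suc (e α₃)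
      i₃< = m<n⇒m<1+n (i<e α₃)
      i₂< : i α₂ < suc (e α₃)
      i₂< = <-trans (<-trans (i<e α₂) e₂<i₃) i₃<
      not : ∀ γ → i γ < suc (e α₃) → q ≢ a γ
      not γ lt q≡ = <⇒≢ (s≤s lt) (At-inj uP (at-a γ) (subst (At P _) q≡ tq))
      q∉ : q ∉ˡ a₁ ∷ a₂ ∷ a₃ ∷ []
      q∉ (here q≡)                 = not α₁ (<-trans (<-trans (i<e α₁) e₁<i₂) i₂<) q≡
      q∉ (there (here q≡))         = not α₂ i₂< q≡
      q∉ (there (there (here q≡))) = not α₃ i₃< q≡

    v≡x₄ : v ≡ x₄
    v≡x₄ with last-index
    ... | l , tl , len with suc (e α₃) ≟ l
    ...   | yes refl = At-det tl (at-y α₃)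
    ...   | no  e≢   = ⊥-elim (x₄-last (proj₂ (At-≤ tl (≤∧≢⇒< (≤-pred (≤-trans (At-< (at-y α₃)) (≤-reflexive (sym len)))) e≢))))

    ¬F-vertices : ∀ {j p} → At P j p → ¬ First.Has p → p ∈ˡ a₁ ∷ a₂ ∷ a₃ ∷ []
    ¬F-vertices {j} {p} t ¬fp with p ∈? (a₁ ∷ a₂ ∷ a₃ ∷ []) | last-index
    ... | yes p∈ | _ = p∈
    ... | no p∉ | l , tl , len with j ≟ l
    ...   | yes refl = ⊥-elim (¬fp (subst First.Has (sym (trans (At-det t tl) v≡x₄)) (First.has-h (Xy α₃))))
    ...   | no j≢    = ⊥-elim (¬F-last t (proj₂ (At-≤ tl (≤∧≢⇒< (≤-pred (≤-trans (At-< t) (≤-reflexive (sym len)))) j≢))) ¬fp (¬F-complete t ¬fp p∉))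

    ¬W-vertices : ∀ {j p} → At P j p → ¬ Last.Has p → p ∈ˡ w₁ ∷ w₂ ∷ w₃ ∷ []
    ¬W-vertices {j} {p} t ¬gp with p ∈? (w₁ ∷ w₂ ∷ w₃ ∷ [])
    ... | yes p∈ = p∈
    ... | no p∉ with j
    ...   | zero  = ⊥-elim (¬gp (subst Last.Has (sym (trans (At-det t (Segments.first Adj sP)) u≡x₁)) (Last.has-h (Xx α₁))))
    ...   | suc l = ⊥-elim (¬W-first (proj₂ (At-≤ t (n≤1+n l))) t ¬gp (¬W-complete t ¬gp p∉))

    -- `h` at index 0, then the ten vertices of `P` in path order; the explicit paths below are
    -- lists of these indices.
    Λ : List (Fin n)
    Λ = h ∷ x₁ ∷ a₁ ∷ w₁ ∷ x₂ ∷ a₂ ∷ w₂ ∷ x₃ ∷ a₃ ∷ w₃ ∷ x₄ ∷ []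

    a⊆Λ : ∀ {p} → p ∈ˡ a₁ ∷ a₂ ∷ a₃ ∷ [] → p ∈ˡ Λ
    a⊆Λ (here refl)                 = ∈-lookup {xs = Λ} 2F
    a⊆Λ (there (here refl))         = ∈-lookup {xs = Λ} 5F
    a⊆Λ (there (there (here refl))) = ∈-lookup {xs = Λ} 8F

    w⊆Λ : ∀ {p} → p ∈ˡ w₁ ∷ w₂ ∷ w₃ ∷ [] → p ∈ˡ Λ
    w⊆Λ (here refl)                 = ∈-lookup {xs = Λ} 3F
    w⊆Λ (there (here refl))         = ∈-lookup {xs = Λ} 6F
    w⊆Λ (there (there (here refl))) = ∈-lookup {xs = Λ} 9F

    -- The predecessor sees no last vertex, hence is one of the `wᵢ`; so the vertex itself is a
    -- neighbour of `h`.
    both-vertices : ∀ {j p} → At P j p → Both p → p ∈ˡ Λ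
    both-vertices {zero}  t _    = subst (_∈ˡ Λ) (sym (trans (At-det t (Segments.first Adj sP)) u≡x₁)) (∈-lookup {xs = Λ} 1F)
    both-vertices {suc l} {p} t both with At-≤ t (n≤1+n l)
    ... | q , tq = go (¬W-vertices tq (proj₂ (before-both tq t both)))
      where
      p≡y : ∀ γ → q ≡ w γ → p ≡ y γ
      p≡y γ eq = At-det t (subst (λ j → At P (suc j) (y γ)) (At-inj uP (at-w γ) (subst (At P l) eq tq)) (at-y γ))
      go : q ∈ˡ w₁ ∷ w₂ ∷ w₃ ∷ [] → p ∈ˡ Λ
      go (here eq)                 = subst (_∈ˡ Λ) (sym (trans (p≡y α₁ eq) y₁≡x₂)) (∈-lookup {xs = Λ} 4F)
      go (there (here eq))         = subst (_∈ˡ Λ) (sym (trans (p≡y α₂ eq) y₂≡x₃)) (∈-lookup {xs = Λ} 7F)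
      go (there (there (here eq))) = subst (_∈ˡ Λ) (sym (p≡y α₃ eq)) (∈-lookup {xs = Λ} 10F)

    covered : ∀ r → r ∈ˡ Λ
    covered r with r ∈? P
    ... | no r∉ = here (only-h r (outside-¬F r∉ , outside-¬W r∉))
    ... | yes r∈ with ∈⇒At r∈ | First.Has? r | Last.Has? r
    ...   | _ , t | no ¬fr | _      = a⊆Λ (¬F-vertices t ¬fr)
    ...   | _ , t | yes _  | no ¬gr = w⊆Λ (¬W-vertices t ¬gr)
    ...   | _ , t | yes fr | yes gr = both-vertices t (fr , gr)

    Point : Set
    Point = ∃₂ λ j p → At P j p

    vertex : Point → Fin n
    vertex (_ , p , _) = p

    points : List Point
    points = (_ , _ , at-x α₁) ∷ (_ , _ , at-a α₁) ∷ (_ , _ , at-w α₁) ∷ (_ , _ , at-x α₂) ∷ (_ , _ , at-a α₂) ∷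
             (_ , _ , at-w α₂) ∷ (_ , _ , at-x α₃) ∷ (_ , _ , at-a α₃) ∷ (_ , _ , at-w α₃) ∷ (_ , _ , at-y α₃) ∷ []

    Λ-unique : Unique Λ
    Λ-unique = All.tabulate (λ r∈ eq → h∉ (subst (_∈ˡ map vertex points) (sym eq) r∈))
      ∷ AllPairsₚ.map⁺ {f = vertex} (AllPairs.map (λ {s} {t} → distinct {s} {t}) (Linkedₚ.Linked⇒AllPairs <-trans increasing))
      where
      h∉ : h ∉ˡ map vertex points
      h∉ h∈ with ∈-map⁻ vertex {xs = points} h∈
      ... | (_ , _ , t) , _ , eq = ∈P⇒≢h t (sym eq)
      distinct : ∀ {s t : Point} → proj₁ s < proj₁ t → vertex s ≢ vertex t
      distinct {_ , _ , t} {_ , _ , t′} lt eq = <⇒≢ lt (At-inj uP t (subst (At P _) (sym eq) t′))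
      increasing : Linked (λ s t → proj₁ s < proj₁ t) points
      increasing = n<1+n _ ∷ 1+i<e α₁ ∷ e₁<i₂ ∷ n<1+n _ ∷ 1+i<e α₂ ∷ e₂<i₃ ∷ n<1+n _ ∷ 1+i<e α₃ ∷ n<1+n _ ∷ [-]

    |P|≤10 : length P ≤ 10
    |P|≤10 = length-⊆ uP sub
      where
      sub : ∀ {r} → r ∈ˡ P → r ∈ˡ map vertex points
      sub {r} r∈ with covered r
      ... | here refl = ⊥-elim (h∉P r∈)
      ... | there r∈′ = r∈′

    -- `P` has at most ten vertices, so a path through all eleven of `Λ` with the same ends would be
    -- longer.
    no-reordering : ∀ ps {_ : True (unique? ps)} → length ps ≡ 11 → ¬ Path G x₁ x₄ (map (lookup Λ) ps)
    no-reordering ps {ups} len s = noLonger (subst₂ (λ p q → Path G p q (map (lookup Λ) ps)) (sym u≡x₁) (sym v≡x₄) s)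
      (Uniq.map⁺ (lookup-injective Λ-unique) (toWitness ups))
      (≤-trans (s≤s |P|≤10) (≤-reflexive (sym (trans (length-map (lookup Λ) ps) len))))

    open Segments Adj using (one; _◂_)

    x~a : ∀ α → Adj (x α) (a α)
    x~a α = At-Cut.z~z⁺ (at-x α) (at-a α)
    w~y : ∀ α → Adj (w α) (y α)
    w~y α = At-Cut.z~z⁺ (at-w α) (at-y α)
    w₁~x₂ : Adj w₁ x₂
    w₁~x₂ = subst (Adj w₁) y₁≡x₂ (w~y α₁)
    w₂~x₃ : Adj w₂ x₃
    w₂~x₃ = subst (Adj w₂) y₂≡x₃ (w~y α₂)

    -- Each of these three Hamiltonian paths uses the assumed edge at `a₂` and otherwise only edges
    -- at `h`, edges of `P` and the six-cycle.
    a₂≁x₁ : ¬ Adj a₂ x₁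
    a₂≁x₁ f = no-reordering (1F ∷ 5F ∷ 6F ∷ 2F ∷ 3F ∷ 4F ∷ 0F ∷ 7F ∷ 8F ∷ 9F ∷ 10F ∷ []) refl
      (adj-sym f ◂ proj₁ a₂~w₂w₃ ◂ adj-sym (proj₂ a₁~w₁w₂) ◂ proj₁ a₁~w₁w₂ ◂ w₁~x₂ ◂ adj-sym (Xx α₂) ◂ Xx α₃ ◂
       x~a α₃ ◂ proj₂ a₃~w₁w₃ ◂ w~y α₃ ◂ one)

    a₂≁x₃ : ¬ Adj a₂ x₃
    a₂≁x₃ f = no-reordering (1F ∷ 0F ∷ 4F ∷ 3F ∷ 2F ∷ 6F ∷ 5F ∷ 7F ∷ 8F ∷ 9F ∷ 10F ∷ []) refl
      (adj-sym (Xx α₁) ◂ Xx α₂ ◂ adj-sym w₁~x₂ ◂ adj-sym (proj₁ a₁~w₁w₂) ◂ proj₂ a₁~w₁w₂ ◂ adj-sym (proj₁ a₂~w₂w₃) ◂ f ◂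
       x~a α₃ ◂ proj₂ a₃~w₁w₃ ◂ w~y α₃ ◂ one)

    a₂≁x₄ : ¬ Adj a₂ x₄
    a₂≁x₄ f = no-reordering (1F ∷ 0F ∷ 4F ∷ 3F ∷ 2F ∷ 6F ∷ 7F ∷ 8F ∷ 9F ∷ 5F ∷ 10F ∷ []) refl
      (adj-sym (Xx α₁) ◂ Xx α₂ ◂ adj-sym w₁~x₂ ◂ adj-sym (proj₁ a₁~w₁w₂) ◂ proj₂ a₁~w₁w₂ ◂ w₂~x₃ ◂ x~a α₃ ◂
       proj₂ a₃~w₁w₃ ◂ adj-sym (proj₂ a₂~w₂w₃) ◂ f ◂ one)

    degree-a₂ : degree G a₂ ≤ 3
    degree-a₂ = ≤-trans (∣subset∣≤ (adj? a₂) {x₂ ∷ w₂ ∷ w₃ ∷ []} (λ {r} f → neighbour f (covered r)))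
      (≤-trans (sumOver-mono (x₂ ∷ w₂ ∷ w₃ ∷ []) (λ {r} _ → ind≤1 (adj? a₂ r))) (≤-reflexive (sumOver-const1 (x₂ ∷ w₂ ∷ w₃ ∷ []))))
      where
      neighbour : ∀ {r} → Adj a₂ r → r ∈ˡ Λ → r ∈ˡ x₂ ∷ w₂ ∷ w₃ ∷ []
      neighbour f (here refl) = ⊥-elim (h≁a α₂ (adj-sym f))
      neighbour f (there (here refl)) = ⊥-elim (a₂≁x₁ f)
      neighbour f (there (there (here refl))) = ⊥-elim (a≁a α₂ α₁ f)
      neighbour f (there (there (there (here refl)))) = ⊥-elim (a₂≁w₁ f)
      neighbour f (there (there (there (there (here refl))))) = here refl
      neighbour f (there (there (there (there (there (here refl)))))) = ⊥-elim (irr f)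
      neighbour f (there (there (there (there (there (there (here refl))))))) = there (here refl)
      neighbour f (there (there (there (there (there (there (there (here refl)))))))) = ⊥-elim (a₂≁x₃ f)
      neighbour f (there (there (there (there (there (there (there (there (here refl))))))))) = ⊥-elim (a≁a α₂ α₃ f)
      neighbour f (there (there (there (there (there (there (there (there (there (here refl)))))))))) = there (there (here refl))
      neighbour f (there (there (there (there (there (there (there (there (there (there (here refl))))))))))) = ⊥-elim (a₂≁x₄ f)

  no-switch : (∀ z → 3 * k ∸ 1 ≤ 2 * degree G z) → ∀ {m z z⁺} → At P m z → At P (suc m) z⁺ → Last.Has z → First.Has z
  no-switch deg {z = z} tz tz⁺ gz = decidable-stable (First.Has? z) λ ¬fz →
    let φ≡1 , k≡3 , len , only-h = exceptional tz tz⁺ gz ¬fz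
        α₁ , α₂ , α₃ , αs≡ , i₂≡ , i₃≡ = three-arcs ch len
        degree≤3 = Exceptional.degree-a₂ φ≡1 k≡3 only-h α₁ α₂ α₃ αs≡ i₂≡ i₃≡
    -- For k = 3 the degree condition asks for 8 ≤ 2 · degree, while degree 3 gives 6.
    in <⇒≱ (s≤s (s≤s (s≤s (s≤s (s≤s (s≤s (s≤s z≤n)))))))
         (≤-trans (subst (λ t → 3 * t ∸ 1 ≤ 2 * degree G (a α₂)) k≡3 (deg (a α₂))) (*-monoʳ-≤ 2 degree≤3))

-- Finite search, path extension and conclusion

-- Makes the existence of a Hamiltonian path decidable, so that a refutation of its absence yields
-- the path itself.
anyList? : ∀ {n} m {Q : List (Fin n) → Set} → Decidable Q → Dec (∃ λ L → length L ≡ m × Q L)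
anyList? zero    Q? = map′ (λ q → [] , refl , q) (λ { ([] , _ , q) → q }) (Q? [])
anyList? (suc m) Q? = map′ (λ (p , L , len , q) → p ∷ L , cong suc len , q)
  (λ { (p ∷ L , len , q) → p , L , suc-injective len , q }) (Finₚ.any? (λ p → anyList? m (λ L → Q? (p ∷ L))))

module _ {n : ℕ} (G : Graph n) where
  open Graph G renaming (sym to adj-sym)
  open Segments Adj
  open import Data.List.Membership.DecPropositional (Finₚ._≟_ {n}) using (_∈?_)
  open import Data.List.Relation.Unary.Unique.DecPropositional (Finₚ._≟_ {n}) using (unique?)

  HamPath? : ∀ u v → Decidable (HamPath G u v)
  HamPath? u v P = unique? P ×-dec Finₚ.all? (_∈? P) ×-dec ≡-dec Finₚ._≟_ (head P) (just u)
    ×-dec ≡-dec Finₚ._≟_ (last P) (just v) ×-dec linked? adj? P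

  Path⇒head : ∀ {u v P} → Path G u v P → head P ≡ just u
  Path⇒head one     = refl
  Path⇒head (_ ◂ _) = refl

  Path⇒last : ∀ {u v P} → Path G u v P → last P ≡ just v
  Path⇒last one           = refl
  Path⇒last (_ ◂ one)     = refl
  Path⇒last (_ ◂ d ◂ s) = Path⇒last (d ◂ s)

  Path⇒Linked : ∀ {u v P} → Path G u v P → Linked Adj P
  Path⇒Linked one           = [-]
  Path⇒Linked (d ◂ one)     = d ∷ [-]
  Path⇒Linked (d ◂ e ◂ s) = d ∷ Path⇒Linked (e ◂ s)

module _ (k n : ℕ) (2≤k : 2 ≤ k) (G : Graph n) (conn : KConnected G (suc k)) (free : K2∪kK1-free G k)
  (deg : ∀ v → 3 * k ∸ 1 ≤ 2 * degree G v) (α<n/2 : ∀ (I : Subset n) → Independent G I → 2 * ∣ I ∣ < n)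
  (u v : Fin n) (u≢v : u ≢ v) where

  open Graph G renaming (sym to adj-sym)
  open import Data.List.Membership.DecPropositional (Finₚ._≟_ {n}) using (_∈?_)

  -- With s = φ + k, the inequality 3k - 1 ≤ 2s says k - 1 ≤ 2φ, and k ≥ 2 makes φ positive.
  degree-excess : ∀ k s d → 2 ≤ k → 3 * k ∸ 1 ≤ 2 * d → d ≤ s →
    ∃ λ φ → 1 ≤ φ × s ≡ φ + k × k ≤ suc (φ + φ)
  -- Matching on `suc k` resolves the truncated subtraction: the left side becomes `k + 2 * suc k`.
  degree-excess (suc k) s d 2≤k 3k-1≤2d d≤s = φ , 1≤φ , s≡φ+k , s≤s k≤2φ
    where
    φ : ℕ
    φ = s ∸ suc k
    3k-1≤2s : k + 2 * suc k ≤ 2 * s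
    3k-1≤2s = ≤-trans 3k-1≤2d (*-monoʳ-≤ 2 d≤s)
    s≡φ+k : s ≡ φ + suc k
    s≡φ+k = sym (m∸n+n≡m {s} {suc k} (*-cancelˡ-≤ 2 (≤-trans (m≤n+m (2 * suc k) k) 3k-1≤2s)))
    k≤2φ : k ≤ φ + φ
    k≤2φ = +-cancelʳ-≤ (2 * suc k) k (φ + φ) (begin
      k + 2 * suc k         ≤⟨ 3k-1≤2s ⟩
      2 * s                 ≡⟨ cong (2 *_) s≡φ+k ⟩
      2 * (φ + suc k)       ≡⟨ *-distribˡ-+ 2 φ (suc k) ⟩
      2 * φ + 2 * suc k     ≡⟨ cong (λ t → φ + t + 2 * suc k) (+-identityʳ φ) ⟩
      φ + φ + 2 * suc k     ∎)
      where open ≤-Reasoning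
    1≤φ : 1 ≤ φ
    1≤φ with φ | k≤2φ
    ... | zero  | k≤0 = ⊥-elim (<⇒≱ (≤-pred 2≤k) k≤0)
    ... | suc _ | _   = s≤s z≤n

  module _ {P : List (Fin n)} (sP : Path G u v P) (uP : Unique P)
    (noLonger : ∀ {Q} → Path G u v Q → Unique Q → length P < length Q → ⊥) where

    outside-independent : ∀ {p q} → p ∉ˡ P → q ∉ˡ P → ¬ Adj p q
    outside-independent = OutsideIndependent.outside-edge-absurd G k free u v u≢v P sP uP noLonger conn

    degree≤ : ∀ {h} → h ∉ˡ P → degree G h ≤ count (adj? h) P
    degree≤ {h} h∉ = ∣subset∣≤ (adj? h) (λ {r} f → decidable-stable (r ∈? P) (λ r∉ → outside-independent h∉ r∉ f))

    not-longest : ∀ {h} → h ∉ˡ P → ⊥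
    not-longest {h} h∉ with Arcs.chain (Adj h) (adj? h) P
    ... | inj₁ none = absurd k 2≤k (≤-trans (deg h) (*-monoʳ-≤ 2 (≤-trans (degree≤ h∉) (≤-reflexive (count-none (adj? h) P (All.lookup none))))))
      where
      absurd : ∀ k → 2 ≤ k → 3 * k ∸ 1 ≤ 0 → ⊥
      absurd (suc k) _ p = <⇒≱ (s≤s z≤n) (≤-trans (m≤n+m (2 * suc k) k) p)
    ... | inj₂ (_ , _ , αs , ch , eq) =
      let φ , 1≤φ , |αs| , k≤ = degree-excess k (suc (length αs)) (degree G h) 2≤k (deg h) (≤-trans (degree≤ h∉) (≤-reflexive eq))
      in Config.large-independent-set G k free u v P sP uP noLonger outside-independent h h∉ ch φ 1≤φ |αs| k≤
           (Config.no-switch G k free u v P sP uP noLonger outside-independent h h∉ ch φ 1≤φ |αs| k≤ deg) α<n/2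

  unique-length≤n : ∀ {L : List (Fin n)} → Unique L → length L ≤ n
  unique-length≤n uL = ≤-trans (length-⊆ uL (λ {r} _ → ∈-allFin r)) (≤-reflexive (length-tabulate {n = n} (λ r → r)))

  -- The fuel bounds the number of vertices still missing. The recursive call is itself the
  -- `noLonger` hypothesis: any longer path is already refuted with less fuel.
  no-path : ¬ (∃ λ L → length L ≡ n × HamPath G u v L) → ∀ fuel {P} → Path G u v P → Unique P → n ≤ length P + fuel → ⊥
  no-path noHam fuel {P} sP uP n≤ with Finₚ.all? (_∈? P)
  ... | yes all = noHam (P , ≤-antisym (unique-length≤n uP)
                   (≤-trans (≤-reflexive (sym (length-tabulate {n = n} (λ r → r)))) (length-⊆ (Uniq.allFin⁺ n) (λ {r} _ → all r))) ,
                   uP , all , Path⇒head G sP , Path⇒last G sP , Path⇒Linked G sP)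
  ... | no ¬all with Finₚ.¬∀⟶∃¬ n _ (_∈? P) ¬all
  ...   | h , h∉ with fuel
  ...     | zero = <⇒≱ (unique-length≤n (All.tabulate (λ r∈ eq → h∉ (subst (_∈ˡ P) (sym eq) r∈)) ∷ uP))
                       (≤-trans n≤ (≤-reflexive (+-identityʳ (length P))))
  ...     | suc fuel′ = not-longest sP uP (λ {Q} sQ uQ lt → no-path noHam fuel′ sQ uQ
              (≤-trans n≤ (≤-trans (≤-reflexive (+-suc (length P) fuel′)) (+-monoˡ-≤ fuel′ lt)))) h∉

  ham-path : ∃ (HamPath G u v)
  ham-path with anyList? n (HamPath? G u v)
  ... | yes (L , _ , ham) = L , ham
  ... | no noHam = ⊥-elim (no-path noHam n (proj₁ (proj₂ start)) (proj₁ (proj₂ (proj₂ start))) (m≤n+m n _))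
    where
    start : ∃ λ L → Path G u v L × Unique L × All (_∉ ⊥ˢ) L
    -- The initial path comes from connectivity with the empty separator.
    start = walk⇒path G (proj₂ conn ⊥ˢ (≤-trans (s≤s (≤-reflexive (∣⊥∣≡0 n))) (s≤s z≤n)) u v ∉⊥ ∉⊥)

theorem1p9 : (k n : ℕ) → 2 ≤ k → (G : Graph n) →
    KConnected G (suc k) →
    K2∪kK1-free G k →
    (∀ v → 3 * k ∸ 1 ≤ 2 * degree G v) →
    (∀ (I : Subset n) → Independent G I → 2 * ∣ I ∣ < n) →
    HamiltonianConnected G
theorem1p9 k n 2≤k G conn free deg α<n/2 u v u≢v = ham-path k n 2≤k G conn free deg α<n/2 u v u≢v
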